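{- If $k\ge 3$ is an integer, then for every positive integer $n$, \[ \mathrm{ex}_3(n,\text{Berge- }C_{2k})\le \frac{2k-3}{3}\, \mathrm{ex}(n,C_{2k}). \]
   Context: All graphs and hypergraphs are finite and simple. $C_{2k}$ is the cycle of length $2k$. A hypergraph $\mathcal{H}$ contains a Berge-$F$ (Berge copy of the graph $F$) if there are an injection $\varphi:V(F)\to V(\mathcal{H})$ and an injection $f:E(F)\to E(\mathcal{H})$ with $\{\varphi(u),\varphi(v)\}\subset f(uv)$ for every edge $uv\in E(F)$; otherwise it is Berge-$F$-free. $\mathrm{ex}_r(n,\text{Berge- }F)$ is the maximum number of hyperedges in an $n$-vertex $r$-uniform Berge-$F$-free hypergraph. $\mathrm{ex}(n,F)$ is the maximum number of edges in an $n$-vertex graph with no (not necessarily induced) subgraph isomorphic to $F$. -}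

module Defs where

open import Data.Bool.Properties using () renaming (_≟_ to _≟ᵇ_)
open import Data.Fin.Base using (Fin; zero; suc; toℕ; combine)
open import Data.Fin.Properties using (any?; all?; toℕ<n; toℕ-fromℕ<; combine-injective; injective⇒≤)
  renaming (_≟_ to _≟ᶠ_)
open import Data.Fin.Subset using (Subset; inside; outside; ⁅_⁆; _∪_; _⊆_; ∣_∣) renaming (_∈_ to _∈ˢ_)
open import Data.Fin.Subset.Properties
  using (anySubset?; _⊆?_; ∣⁅x⁆∣≡1; ∪-identityˡ; ∪-identityʳ; x∈p∪q⁻; x∈p∪q⁺; x∈⁅x⁆; x∈⁅y⁆⇒x≡y)
open import Data.List.Base using (List; length; lookup; tabulate)
open import Data.List.Membership.Propositional using (_∈_)
open import Data.List.Membership.Propositional.Properties using (∈-lookup)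
open import Data.List.Relation.Unary.All as All using (All; []; _∷_)
import Data.List.Relation.Unary.All.Properties as Allₚ
import Data.List.Relation.Unary.AllPairs as AllPairs
open import Data.List.Relation.Unary.Unique.Propositional using (Unique; []; _∷_)
import Data.List.Relation.Unary.Unique.Propositional.Properties as Uniqueₚ
open import Data.Nat.Base using (ℕ; zero; suc; _+_; _*_; _^_; _≤_; _≥_; z≤n; s≤s; s≤s⁻¹)
open import Data.Nat.DivMod using (_mod_; _%_; m<n⇒m%n≡m; n%n≡0; m%n<n)
open import Data.Nat.Properties
  using (≤-trans; <-irrefl; n<1+n; m≤m+n; m<n⇒m<1+n; m≤n⇒m<n∨m≡n; ≡-irrelevant)
  renaming (_≟_ to _≟ⁿ_)
open import Data.Product.Base using (∃; _×_; _,_; proj₁; proj₂)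
open import Data.Sum.Base using (_⊎_; inj₁; inj₂)
open import Data.Vec.Base as Vec using (Vec; []; _∷_; fromList; toList)
import Data.Vec.Properties as Vecₚ
open import Function.Base using (_∘_)
open import Function.Definitions using (Injective)
open import Relation.Binary.Definitions using (DecidableEquality)
open import Relation.Binary.PropositionalEquality
open import Relation.Nullary using (Dec; yes; no; ¬_; contradiction)
open import Relation.Nullary.Decidable using (map′; _×-dec_; _→-dec_; ¬?)
open import Relation.Unary using (Decidable)

-- Simple r-uniform hypergraphs on the vertex set Fin n.  The list only
-- represents a set of hyperedges: its order is irrelevant.

record Hypergraph (r n : ℕ) : Set where
  constructor mkHypergraph
  field
    edges   : List (Subset n)
    unique  : Unique edges
    uniform : All (λ e → ∣ e ∣ ≡ r) edges

  size : ℕ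
  size = length edges

  Edge : Set
  Edge = Fin size

  vertices : Edge → Subset n
  vertices = lookup edges

open Hypergraph public

Graph : ℕ → Set
Graph = Hypergraph 2

pair : ∀ {n} → Fin n → Fin n → Subset n
pair u v = ⁅ u ⁆ ∪ ⁅ v ⁆

-- G has a (not necessarily induced) subgraph isomorphic to F.

record Copy {m n} (F : Graph m) (G : Graph n) : Set where
  field
    φ           : Fin m → Fin n
    φ-injective : Injective _≡_ _≡_ φ
    φ-edge      : ∀ u v → pair u v ∈ edges F → pair (φ u) (φ v) ∈ edges G

record BergeCopy {m n r} (F : Graph m) (H : Hypergraph r n) : Set where
  field
    φ           : Fin m → Fin n
    φ-injective : Injective _≡_ _≡_ φ
    f           : Edge F → Edge H
    f-injective : Injective _≡_ _≡_ f
    f-edge      : ∀ e u v → vertices F e ≡ pair u v → pair (φ u) (φ v) ⊆ vertices H (f e)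

Free : ∀ {m n} → Graph m → Graph n → Set
Free F G = ¬ Copy F G

BergeFree : ∀ {m n r} → Graph m → Hypergraph r n → Set
BergeFree F H = ¬ BergeCopy F H

anyVec? : ∀ {A : Set} → (∀ {P : A → Set} → Decidable P → Dec (∃ P)) →
          ∀ {k} {P : Vec A k → Set} → Decidable P → Dec (∃ P)
anyVec? search {zero}  P? = map′ ([] ,_) (λ { ([] , p) → p }) (P? [])
anyVec? search {suc k} P? =
  map′ (λ { (x , xs , p) → x ∷ xs , p }) (λ { (x ∷ xs , p) → x , xs , p })
       (search λ x → anyVec? search λ xs → P? (x ∷ xs))

-- The first argument replaces function extensionality.

anyFunction? : ∀ {k n} {P : (Fin k → Fin n) → Set} → (∀ {g h} → g ≗ h → P g → P h) →
               Decidable P → Dec (∃ P)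
anyFunction? resp P? =
  map′ (λ { (v , p) → Vec.lookup v , p })
       (λ { (g , p) → Vec.tabulate g , resp (sym ∘ Vecₚ.lookup∘tabulate g) p })
       (anyVec? any? (P? ∘ Vec.lookup))

Inj : ∀ {k n} → (Fin k → Fin n) → Set
Inj g = ∀ x y → g x ≡ g y → x ≡ y

inj? : ∀ {k n} (g : Fin k → Fin n) → Dec (Inj g)
inj? g = all? λ x → all? λ y → (g x ≟ᶠ g y) →-dec (x ≟ᶠ y)

inj-resp : ∀ {k n} {g h : Fin k → Fin n} → g ≗ h → Inj g → Inj h
inj-resp g≗h inj x y eq = inj x y (trans (g≗h x) (trans eq (sym (g≗h y))))

_≟ˢ_ : ∀ {n} → DecidableEquality (Subset n)
_≟ˢ_ = Vecₚ.≡-dec _≟ᵇ_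

module _ {n : ℕ} where
  open import Data.List.Membership.DecPropositional (_≟ˢ_ {n}) public using (_∈?_)
  open import Data.List.Relation.Unary.Unique.DecPropositional (_≟ˢ_ {n}) public using (unique?)

copy? : ∀ {m n} (F : Graph m) (G : Graph n) → Dec (Copy F G)
copy? F G =
  map′ (λ { (φ , inj , edge) → record { φ = φ ; φ-injective = inj _ _ ; φ-edge = edge } })
       (λ c → let open Copy c in φ , (λ _ _ → φ-injective) , φ-edge)
       (anyFunction?
         (λ g≗h (inj , edge) → inj-resp g≗h inj ,
            λ u v uv → subst (_∈ edges G) (cong₂ pair (g≗h u) (g≗h v)) (edge u v uv))
         (λ φ → inj? φ ×-dec
            all? λ u → all? λ v → (pair u v ∈? edges F) →-dec (pair (φ u) (φ v) ∈? edges G)))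

bergeCopy? : ∀ {m n r} (F : Graph m) (H : Hypergraph r n) → Dec (BergeCopy F H)
bergeCopy? {m} {n} F H =
  map′ (λ { (φ , φi , f , fi , fe) →
            record { φ = φ ; φ-injective = φi _ _ ; f = f ; f-injective = fi _ _ ; f-edge = fe } })
       (λ c → let open BergeCopy c in φ , (λ _ _ → φ-injective) , f , (λ _ _ → f-injective) , f-edge)
       (anyFunction?
         (λ g≗h (φi , f , fi , fe) → inj-resp g≗h φi , f , fi , λ e u v eq →
            subst (_⊆ vertices H (f e)) (cong₂ pair (g≗h u) (g≗h v)) (fe e u v eq))
         (λ φ → inj? φ ×-dec anyFunction?
           (λ g≗h (fi , fe) → inj-resp g≗h fi , λ e u v eq →
              subst (λ e′ → pair (φ u) (φ v) ⊆ vertices H e′) (g≗h e) (fe e u v eq))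
           (λ f → inj? f ×-dec
              all? λ e → all? λ u → all? λ v →
                (vertices F e ≟ˢ pair u v) →-dec (pair (φ u) (φ v) ⊆? vertices H (f e)))))

hypergraph-≡ : ∀ {r n} {G H : Hypergraph r n} → edges G ≡ edges H → G ≡ H
hypergraph-≡ {G = mkHypergraph es u w} {mkHypergraph .es u′ w′} refl =
  cong₂ (mkHypergraph es) (AllPairs.irrelevant (λ _ _ → refl) u u′) (All.irrelevant ≡-irrelevant w w′)

HasSize : ∀ {r n} → (Hypergraph r n → Set) → ℕ → Set
HasSize P s = ∃ λ H → P H × size H ≡ s

hasSize? : ∀ {r n} {P : Hypergraph r n → Set} → Decidable P → Decidable (HasSize P)
hasSize? {r} {n} {P} P? s = map′ to from (anyVec? anySubset? good?)
  where
  Good : Vec (Subset n) s → Set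
  Good v = ∃ λ H → P H × edges H ≡ toList v

  good? : Decidable Good
  good? v with unique? (toList v) | All.all? (λ e → ∣ e ∣ ≟ⁿ r) (toList v)
  ... | no ¬u | _     = no λ { (H , _ , eq) → ¬u (subst Unique eq (unique H)) }
  ... | yes _ | no ¬w = no λ { (H , _ , eq) → ¬w (subst (All _) eq (uniform H)) }
  ... | yes u | yes w =
    map′ (λ p → mkHypergraph (toList v) u w , p , refl)
         (λ { (H , p , eq) → subst P (hypergraph-≡ eq) p })
         (P? (mkHypergraph (toList v) u w))

  to : ∃ Good → HasSize P s
  to (v , H , p , eq) = H , p , trans (cong length eq) (Vecₚ.length-toList v)

  from : HasSize P s → ∃ Good
  from (H , p , refl) = fromList (edges H) , H , p , sym (Vecₚ.toList∘fromList (edges H))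

-- The largest s ≤ N with Q s, and 0 if there is none.

largest : ∀ {Q : ℕ → Set} → Decidable Q → ℕ → ℕ
largest Q? zero = zero
largest Q? (suc N) with Q? (suc N)
... | yes _ = suc N
... | no  _ = largest Q? N

-- An n-vertex hypergraph has at most 2 ^ n hyperedges (size≤2^n below).
-- If no hypergraph satisfies P then maxSize P? is 0; otherwise it is the
-- maximum, by maxSize-upper and maxSize-attained.

maxSize : ∀ {r n} {P : Hypergraph r n → Set} → Decidable P → ℕ
maxSize {n = n} P? = largest (hasSize? P?) (2 ^ n)

ex : ∀ {m} → ℕ → Graph m → ℕ
ex n F = maxSize {2} {n} {Free F} (λ G → ¬? (copy? F G))

ex-Berge : ∀ {m} (r n : ℕ) → Graph m → ℕ
ex-Berge r n F = maxSize {r} {n} {BergeFree F} (λ H → ¬? (bergeCopy? F H))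

largest-upper : ∀ {Q : ℕ → Set} (Q? : Decidable Q) N {s} → Q s → s ≤ N → s ≤ largest Q? N
largest-upper Q? zero    q s≤0 = s≤0
largest-upper Q? (suc N) q s≤ with Q? (suc N)
... | yes _ = s≤
... | no ¬q with m≤n⇒m<n∨m≡n s≤
...   | inj₁ s< = largest-upper Q? N q (s≤s⁻¹ s<)
...   | inj₂ refl = contradiction q ¬q

largest-attained : ∀ {Q : ℕ → Set} (Q? : Decidable Q) N {s} → Q s → s ≤ N → Q (largest Q? N)
largest-attained Q? zero    q z≤n = q
largest-attained Q? (suc N) q s≤ with Q? (suc N)
... | yes p = p
... | no ¬q with m≤n⇒m<n∨m≡n s≤
...   | inj₁ s< = largest-attained Q? N q (s≤s⁻¹ s<)
...   | inj₂ refl = contradiction q ¬q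

lookup-injective : ∀ {A : Set} {xs : List A} → Unique xs → Injective _≡_ _≡_ (lookup xs)
lookup-injective (_ ∷ _)  {zero}  {zero}  _  = refl
lookup-injective (x ∷ _)  {zero}  {suc j} eq = contradiction eq (All.lookup x (∈-lookup j))
lookup-injective (x ∷ _)  {suc i} {zero}  eq = contradiction (sym eq) (All.lookup x (∈-lookup i))
lookup-injective (_ ∷ xs) {suc i} {suc j} eq = cong suc (lookup-injective xs eq)

code : ∀ {n} → Subset n → Fin (2 ^ n)
code []            = zero
code (outside ∷ p) = combine {2} zero (code p)
code (inside  ∷ p) = combine {2} (suc zero) (code p)

code-injective : ∀ {n} → Injective _≡_ _≡_ (code {n})
code-injective {x = []} {[]} _ = refl
code-injective {x = outside ∷ p} {outside ∷ q} eq =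
  cong (outside ∷_) (code-injective (proj₂ (combine-injective {2} zero (code p) zero (code q) eq)))
code-injective {x = inside ∷ p} {inside ∷ q} eq =
  cong (inside ∷_) (code-injective (proj₂ (combine-injective {2} (suc zero) (code p) (suc zero) (code q) eq)))
code-injective {x = outside ∷ p} {inside ∷ q} eq
  with () ← proj₁ (combine-injective {2} zero (code p) (suc zero) (code q) eq)
code-injective {x = inside ∷ p} {outside ∷ q} eq
  with () ← proj₁ (combine-injective {2} (suc zero) (code p) zero (code q) eq)

size≤2^n : ∀ {r n} (H : Hypergraph r n) → size H ≤ 2 ^ n
size≤2^n H = injective⇒≤ {f = code ∘ vertices H} (lookup-injective (unique H) ∘ code-injective)

maxSize-upper : ∀ {r n} {P : Hypergraph r n → Set} (P? : Decidable P) →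
                ∀ {H} → P H → size H ≤ maxSize P?
maxSize-upper {n = n} P? {H} p = largest-upper (hasSize? P?) (2 ^ n) (H , p , refl) (size≤2^n H)

maxSize-attained : ∀ {r n} {P : Hypergraph r n → Set} (P? : Decidable P) →
                   ∃ P → ∃ λ H → P H × size H ≡ maxSize P?
maxSize-attained {n = n} P? (H , p) =
  largest-attained (hasSize? P?) (2 ^ n) (H , p , refl) (size≤2^n H)

next : ∀ {m} → Fin m → Fin m
next {suc m} i = suc (toℕ i) mod suc m

toℕ-next : ∀ {m} (i : Fin m) →
           (toℕ (next i) ≡ suc (toℕ i)) ⊎ (toℕ (next i) ≡ 0 × suc (toℕ i) ≡ m)
toℕ-next {suc m} i with m≤n⇒m<n∨m≡n (toℕ<n i)
... | inj₁ lt = inj₁ (trans (toℕ-fromℕ< (m%n<n (suc (toℕ i)) (suc m))) (m<n⇒m%n≡m lt))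
... | inj₂ eq = inj₂ (trans (toℕ-fromℕ< (m%n<n (suc (toℕ i)) (suc m)))
                            (trans (cong (_% suc m) eq) (n%n≡0 (suc m))) , eq)

next≢ : ∀ {m} → m ≥ 2 → (i : Fin m) → i ≢ next i
next≢ m≥2 i eq with toℕ-next i
... | inj₁ p = <-irrefl (trans (cong toℕ eq) p) (n<1+n (toℕ i))
... | inj₂ (p , q) = <-irrefl (trans (cong suc (sym (trans (cong toℕ eq) p))) q) m≥2

next²≢ : ∀ {m} → m ≥ 3 → (i : Fin m) → i ≢ next (next i)
next²≢ m≥3 i eq with toℕ-next i | toℕ-next (next i)
... | inj₁ p | inj₁ q =
  <-irrefl (trans (cong toℕ eq) (trans q (cong suc p))) (m<n⇒m<1+n (n<1+n (toℕ i)))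
... | inj₁ p | inj₂ (q , r) =
  <-irrefl (trans (cong (2 +_) (sym (trans (cong toℕ eq) q))) (trans (cong suc (sym p)) r)) m≥3
... | inj₂ (p , r) | inj₁ q =
  <-irrefl (trans (cong suc (sym (trans (cong toℕ eq) (trans q (cong suc p))))) r) m≥3
... | inj₂ (p , r) | inj₂ (q , s) =
  <-irrefl (trans (cong suc (sym p)) s) (≤-trans (s≤s (s≤s z≤n)) m≥3)

∣pair∣≡2 : ∀ {n} {x y : Fin n} → x ≢ y → ∣ pair x y ∣ ≡ 2
∣pair∣≡2 {x = zero}  {zero}  x≢y = contradiction refl x≢y
∣pair∣≡2 {x = zero}  {suc y} x≢y = cong suc (trans (cong ∣_∣ (∪-identityˡ ⁅ y ⁆)) (∣⁅x⁆∣≡1 y))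
∣pair∣≡2 {x = suc x} {zero}  x≢y = cong suc (trans (cong ∣_∣ (∪-identityʳ ⁅ x ⁆)) (∣⁅x⁆∣≡1 x))
∣pair∣≡2 {x = suc x} {suc y} x≢y = ∣pair∣≡2 (x≢y ∘ cong suc)

∈-pair⁻ : ∀ {n} {x u v : Fin n} → x ∈ˢ pair u v → x ≡ u ⊎ x ≡ v
∈-pair⁻ {u = u} {v} x∈ with x∈p∪q⁻ ⁅ u ⁆ ⁅ v ⁆ x∈
... | inj₁ p = inj₁ (x∈⁅y⁆⇒x≡y u p)
... | inj₂ p = inj₂ (x∈⁅y⁆⇒x≡y v p)

cycleEdge-injective : ∀ {m} → m ≥ 3 → {i j : Fin m} → pair i (next i) ≡ pair j (next j) → i ≡ j
cycleEdge-injective m≥3 {i} {j} eq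
  with ∈-pair⁻ (subst (i ∈ˢ_) eq (x∈p∪q⁺ (inj₁ (x∈⁅x⁆ i))))
     | ∈-pair⁻ (subst (j ∈ˢ_) (sym eq) (x∈p∪q⁺ (inj₁ (x∈⁅x⁆ j))))
... | inj₁ i≡j | _        = i≡j
... | inj₂ _   | inj₁ j≡i = sym j≡i
... | inj₂ p   | inj₂ q   = contradiction (trans p (cong next q)) (next²≢ m≥3 i)

-- The cycle on Fin m with edges {i , i + 1 mod m}.

C : ∀ m → m ≥ 3 → Graph m
C m m≥3 = mkHypergraph
  (tabulate λ i → pair i (next i))
  (Uniqueₚ.tabulate⁺ (cycleEdge-injective m≥3))
  (Allₚ.tabulate⁺ λ i → ∣pair∣≡2 (next≢ (≤-trans (s≤s (s≤s z≤n)) m≥3) i))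

2*k≥3 : ∀ {k} → k ≥ 3 → 2 * k ≥ 3
2*k≥3 {k} k≥3 = ≤-trans k≥3 (m≤m+n k _)

{-# OPTIONS --safe #-}
-- Take a maximum matching between the hyperedges of a Berge-C₂ₖ-free H and the
-- pairs contained in them.  The matched pairs form a C₂ₖ-free graph G.  By
-- Kőnig's theorem G splits into blue and red pairs so that each hyperedge
-- either is matched to its own red pair or has all its pairs blue.  In the blue
-- graph no neighbourhood contains a path on 2k − 1 vertices, so by Erdős–Gallai
-- the link of v has at most (2k − 3) d(v) / 2 edges; summing over v, there are
-- at most (2k − 3) / 3 blue triangles per blue pair.  Since (2k − 3) / 3 ≥ 1 for
-- k ≥ 3, the red pairs satisfy the same bound.
module Submission where

open import Defs

-- The obstacle is that a matched hyperedge may have pairs outside G, so the triangles of G need not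
-- account for all of H. The cover given by Kőnig's theorem separates the hyperedges that are
-- triangles of blue pairs from those that have to be paid for by a pair of their own. The matching
-- is not chosen maximum and then analysed: it is built one hyperedge at a time, together with its
-- cover. G has no forbidden cycle because the edges of such a cycle are matched to distinct
-- hyperedges containing them, which is a Berge cycle. Below, `q` stands for 2k - 3. A path on
-- `2 + q` vertices in the neighbourhood of v closes up through v to a cycle on `3 + q` vertices.
-- Everything is counted in ordered tuples, so that no division occurs: a hyperedge gives six
-- ordered triples, a blue pair two ordered pairs, and the Erdős-Gallai bound is stated for the
-- degree sum, which is twice the number of edges.

module BergeCycles where

  open import Data.Bool.Base using (if_then_else_; true; false)
  open import Data.Fin.Base using (Fin; zero; suc; toℕ)
  open import Data.Fin.Properties using (¬Fin0) renaming (_≟_ to _≟ᶠ_)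
  open import Data.Fin.Subset
    using (Subset; inside; outside; ⁅_⁆; ∣_∣; _⊆_; _-_)
    renaming (_∈_ to _∈ˢ_)
  open import Data.Fin.Subset.Properties
    using (nonempty?; Empty-unique; ∣⊥∣≡0; ∣⁅x⁆∣≡1; p─⊥≡p; p─q⊆p; x∈p∧x≢y⇒x∈p-y; x∈p∪q⁺; x∈⁅x⁆;
           ⊆-antisym; ⊆-reflexive; ∪-idem; _⊆?_; anySubset?)
    renaming (_∈?_ to _∈ˢ?_)
  import Data.Integer.Base as ℤ
  import Data.Integer.Properties as ℤₚ
  open import Data.List.Base
    using (List; []; _∷_; _++_; length; map; filter; [_]; lookup; tabulate; allFin)
  import Data.List.Membership.DecPropositional as DecMembership
  open import Data.List.Membership.Propositional using (_∈_; find; lose; _∉_)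
  open import Data.List.Membership.Propositional.Properties
    using (∈-∃++; ∈-++⁺ˡ; ∈-++⁺ʳ; ∈-++⁻; ∈-map⁺; ∈-map⁻; ∈-filter⁻; ∈-tabulate⁻; ∈-lookup)
  open import Data.List.Properties using (map-++; length-++; ++-assoc; length-map; map-tabulate)
  open import Data.List.Relation.Binary.Permutation.Propositional
    using (_↭_; ↭-refl; ↭-sym; ↭-trans; ↭-prep; ↭-reflexive; ↭-swap; ↭⇒↭ₛ)
  import Data.List.Relation.Binary.Permutation.Propositional.Properties as Perm
  import Data.List.Relation.Binary.Permutation.Setoid.Properties as Permₛ
  open import Data.List.Relation.Unary.All as All using (All; []; _∷_)
  import Data.List.Relation.Unary.All.Properties as Allₚ
  open import Data.List.Relation.Unary.Any using (here; there; Any; any?; index)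
  open import Data.List.Relation.Unary.Any.Properties using (lookup-index)
  open import Data.List.Relation.Unary.Unique.Propositional using (Unique; _∷_; [])
  import Data.List.Relation.Unary.Unique.Propositional.Properties as Uniqueₚ
  open import Data.Nat.Base using (ℕ; zero; suc; _+_; _*_; _≤_; z≤n; s≤s; _<_; s≤s⁻¹; _≥_)
  open import Data.Nat.ListAction using (sum)
  open import Data.Nat.ListAction.Properties using (sum-++; sum-↭)
  open import Data.Nat.Properties
  open import Data.Nat.Tactic.RingSolver using (solve-∀)
  open import Data.Product.Base using (_×_; _,_; ∃; ∃₂; proj₁; proj₂; uncurry)
  import Data.Rational.Base as ℚ
  import Data.Rational.Properties as ℚₚ
  import Data.Rational.Unnormalised.Base as ℚᵘ
  import Data.Rational.Unnormalised.Properties as ℚᵘₚ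
  open import Data.Sum.Base using (_⊎_; inj₁; inj₂)
  open import Data.Vec.Base using ([]; _∷_; here; there)
  open import Function.Base using (_∘_; id)
  open import Function.Definitions using (Injective)
  open import Relation.Binary.Definitions using (DecidableEquality)
  open import Relation.Binary.PropositionalEquality hiding ([_])
  open import Relation.Nullary using (Dec; does; yes; no; ¬_; contradiction)
  open import Relation.Nullary.Decidable using (_×-dec_; ¬?; decidable-stable)
  open import Relation.Unary using (Decidable)

  -- Finite sums over lists and indicators of decidable propositions

  ∑ : {A : Set} → List A → (A → ℕ) → ℕ
  ∑ xs f = sum (map f xs)

  ⟦_⟧ : {P : Set} → Dec P → ℕ
  ⟦ P? ⟧ = if does P? then 1 else 0

  ⟦⟧-yes : {P : Set} (P? : Dec P) → P → ⟦ P? ⟧ ≡ 1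
  ⟦⟧-yes (yes _) p = refl
  ⟦⟧-yes (no ¬p) p = contradiction p ¬p

  ⟦⟧-no : {P : Set} (P? : Dec P) → ¬ P → ⟦ P? ⟧ ≡ 0
  ⟦⟧-no (yes p) ¬p = contradiction p ¬p
  ⟦⟧-no (no _)  ¬p = refl

  ⟦⟧≤1 : {P : Set} (P? : Dec P) → ⟦ P? ⟧ ≤ 1
  ⟦⟧≤1 (yes _) = s≤s z≤n
  ⟦⟧≤1 (no _)  = z≤n

  ⟦×⟧ : {P Q : Set} (P? : Dec P) (Q? : Dec Q) → ⟦ P? ×-dec Q? ⟧ ≡ ⟦ P? ⟧ * ⟦ Q? ⟧
  ⟦×⟧ (yes _) Q? = sym (+-identityʳ ⟦ Q? ⟧)
  ⟦×⟧ (no _)  Q? = refl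

  module _ {A : Set} where

    ∑-++ : ∀ xs ys {f : A → ℕ} → ∑ (xs ++ ys) f ≡ ∑ xs f + ∑ ys f
    ∑-++ xs ys {f} = trans (cong sum (map-++ f xs ys)) (sum-++ (map f xs) (map f ys))

    ∑-↭ : ∀ {xs ys} {f : A → ℕ} → xs ↭ ys → ∑ xs f ≡ ∑ ys f
    ∑-↭ {f = f} xs↭ys = sum-↭ (Perm.map⁺ f xs↭ys)

    ∑-mono : ∀ xs {f g : A → ℕ} → (∀ {x} → x ∈ xs → f x ≤ g x) → ∑ xs f ≤ ∑ xs g
    ∑-mono []       f≤g = z≤n
    ∑-mono (x ∷ xs) f≤g = +-mono-≤ (f≤g (here refl)) (∑-mono xs λ x∈xs → f≤g (there x∈xs))

    ∑-cong : ∀ xs {f g : A → ℕ} → (∀ {x} → x ∈ xs → f x ≡ g x) → ∑ xs f ≡ ∑ xs g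
    ∑-cong xs f≡g = ≤-antisym (∑-mono xs λ x∈xs → ≤-reflexive (f≡g x∈xs))
                              (∑-mono xs λ x∈xs → ≤-reflexive (sym (f≡g x∈xs)))

    ∑-const : ∀ (xs : List A) c → ∑ xs (λ _ → c) ≡ length xs * c
    ∑-const []       c = refl
    ∑-const (x ∷ xs) c = cong (c +_) (∑-const xs c)

    ∑-zero : ∀ xs {f : A → ℕ} → (∀ {x} → x ∈ xs → f x ≡ 0) → ∑ xs f ≡ 0
    ∑-zero xs f≡0 = trans (∑-cong xs f≡0) (trans (∑-const xs 0) (*-zeroʳ (length xs)))

    ∑-+ : ∀ xs {f g : A → ℕ} → ∑ xs (λ x → f x + g x) ≡ ∑ xs f + ∑ xs g
    ∑-+ []       = refl
    ∑-+ (x ∷ xs) {f} {g} =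
      trans (cong (f x + g x +_) (∑-+ xs)) (interchange (f x) (g x) (∑ xs f) (∑ xs g))
      where
      interchange : ∀ a b c d → a + b + (c + d) ≡ a + c + (b + d)
      interchange = solve-∀

    ∑-* : ∀ xs c {f : A → ℕ} → ∑ xs (λ x → c * f x) ≡ c * ∑ xs f
    ∑-* []       c     = sym (*-zeroʳ c)
    ∑-* (x ∷ xs) c {f} = trans (cong (c * f x +_) (∑-* xs c)) (sym (*-distribˡ-+ c (f x) (∑ xs f)))

    module _ {P : A → Set} (P? : Decidable P) where

      ∑-filter : ∀ xs {f : A → ℕ} → ∑ (filter P? xs) f ≡ ∑ xs (λ x → ⟦ P? x ⟧ * f x)
      ∑-filter []       = refl
      ∑-filter (x ∷ xs) {f} with does (P? x)
      ... | true  = cong₂ _+_ (sym (+-identityʳ (f x))) (∑-filter xs)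
      ... | false = ∑-filter xs

      length-filter : ∀ xs → length (filter P? xs) ≡ ∑ xs (λ x → ⟦ P? x ⟧)
      length-filter []       = refl
      length-filter (x ∷ xs) with does (P? x)
      ... | true  = cong suc (length-filter xs)
      ... | false = length-filter xs

      -- This turns an injectivity argument into an inequality of sums: it is used to show that a
      -- triple of vertices is charged by at most one hyperedge, and only if it is a triangle.
      ∑-atMostOne : ∀ {xs} {Q : Set} (Q? : Dec Q) → Unique xs →
                    (∀ {x y} → x ∈ xs → y ∈ xs → P x → P y → x ≡ y) →
                    (∀ {x} → x ∈ xs → P x → Q) → ∑ xs (λ x → ⟦ P? x ⟧) ≤ ⟦ Q? ⟧
      ∑-atMostOne {[]}     Q? _             _    _   = z≤n
      ∑-atMostOne {x ∷ xs} Q? (x∉xs ∷ uniq) same P⇒Q with P? x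
      ... | no _  = ∑-atMostOne Q? uniq (λ x∈ y∈ → same (there x∈) (there y∈)) (λ x∈ → P⇒Q (there x∈))
      ... | yes p = ≤-reflexive (trans (cong suc rest) (sym (⟦⟧-yes Q? (P⇒Q (here refl) p))))
        where
        rest : ∑ xs (λ x → ⟦ P? x ⟧) ≡ 0
        rest = ∑-zero xs λ y∈ → ⟦⟧-no (P? _) λ q →
          All.lookup x∉xs y∈ (same (here refl) (there y∈) p q)

  ∑-swap : ∀ {A B : Set} (xs : List A) (ys : List B) {f : A → B → ℕ} →
           ∑ xs (λ x → ∑ ys (f x)) ≡ ∑ ys (λ y → ∑ xs (λ x → f x y))
  ∑-swap []       ys     = sym (∑-zero ys λ _ → refl)
  ∑-swap (x ∷ xs) ys {f} = trans (cong (∑ ys (f x) +_) (∑-swap xs ys)) (sym (∑-+ ys))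

  ∑-∋ : ∀ {A : Set} {xs : List A} {x} (f : A → ℕ) → x ∈ xs → f x ≤ ∑ xs f
  ∑-∋ f (here refl) = m≤m+n _ _
  ∑-∋ f (there x∈)  = ≤-trans (∑-∋ f x∈) (m≤n+m _ _)

  -- The Erdős–Gallai bound

  m+1+n≡1+o⇒m≤o : ∀ {m n o} → m + suc n ≡ suc o → m ≤ o
  m+1+n≡1+o⇒m≤o {m} {n} eq = m+n≤o⇒m≤o m (≤-reflexive (suc-injective (trans (sym (+-suc m n)) eq)))

  ∈⇒↭ : ∀ {A : Set} {x : A} {xs} → x ∈ xs → ∃ λ ys → xs ↭ x ∷ ys
  ∈⇒↭ x∈xs with ys , zs , refl ← ∈-∃++ x∈xs = ys ++ zs , Perm.shift _ ys zs

  module Walks {V : Set} (E : V → V → Set) where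

    data Walk : V → V → List V → Set where
      single : ∀ v → Walk v v [ v ]
      _∷_    : ∀ {u v w xs} → E u v → Walk v w xs → Walk u w (u ∷ xs)

    join : ∀ {u v w z xs ys} → Walk u v xs → E v w → Walk w z ys → Walk u z (xs ++ ys)
    join (single _) vw q = vw ∷ q
    join (uv ∷ p)   vw q = uv ∷ join p vw q

    head∈ : ∀ {u v xs} → Walk u v xs → u ∈ xs
    head∈ (single _) = here refl
    head∈ (_ ∷ _)    = here refl

    last∈ : ∀ {u v xs} → Walk u v xs → v ∈ xs
    last∈ (single _) = here refl
    last∈ (_ ∷ p)    = there (last∈ p)

    length>0 : ∀ {u v xs} → Walk u v xs → 0 < length xs
    length>0 (single _) = s≤s z≤n
    length>0 (_ ∷ _)    = s≤s z≤n

    split : ∀ {u v w xs} → Walk u v xs → w ∈ xs →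
            w ≡ u ⊎ ∃₂ λ ys zs → ∃ λ a → Walk u a ys × E a w × Walk w v zs × ys ++ zs ≡ xs
    split (single _) (here refl) = inj₁ refl
    split (_ ∷ _)    (here refl) = inj₁ refl
    split (uv ∷ p)   (there w∈) with split p w∈
    ... | inj₁ refl = inj₂ (_ , _ , _ , single _ , uv , p , refl)
    ... | inj₂ (ys , zs , a , p₁ , aw , p₂ , refl) =
      inj₂ (_ ∷ ys , zs , a , uv ∷ p₁ , aw , p₂ , refl)

    -- The edge from `v` back to `u` makes the walk a closed one, which can be cut open just before
    -- any of its vertices.
    rotate : ∀ {u v w xs} → Walk u v xs → E v u → w ∈ xs →
             ∃₂ λ z ys → Walk w z ys × ys ↭ xs
    rotate p vu w∈ with split p w∈
    ... | inj₁ refl = _ , _ , p , ↭-refl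
    ... | inj₂ (ys , zs , a , p₁ , _ , p₂ , refl) = a , zs ++ ys , join p₂ vu p₁ , Perm.++-comm zs ys

    module _ (E-sym : ∀ {u v} → E u v → E v u) where

      reverseWalk : ∀ {u v xs} → Walk u v xs → ∃ λ ys → Walk v u ys × ys ↭ xs
      reverseWalk (single v) = _ , single v , ↭-refl
      reverseWalk (_∷_ {u} uv p) with ys , q , ys↭ ← reverseWalk p =
        ys ++ [ u ] , join q (E-sym uv) (single u) ,
        ↭-trans (Perm.++-comm ys [ u ]) (↭-prep u ys↭)

      -- The cycle runs b ⋯ z a ⋯ u and back to b.
      closeUp : ∀ {u a b z xs ys} → Walk u a xs → Walk b z ys → E u b → E z a →
                ∃ λ zs → Walk b u zs × E u b × zs ↭ xs ++ ys
      closeUp {xs = xs} {ys} p q ub za with xs′ , p′ , xs′↭ ← reverseWalk p =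
        ys ++ xs′ , join q za p′ , ub , ↭-trans (Perm.++⁺ˡ ys xs′↭) (Perm.++-comm ys xs)

  module ErdősGallai {V : Set} {E : V → V → Set} (E? : ∀ u v → Dec (E u v))
                     (E-sym : ∀ {u v} → E u v → E v u) (E-irrefl : ∀ {v} → ¬ E v v) where

    open Walks E

    deg : List V → V → ℕ
    deg W u = ∑ W λ w → ⟦ E? u w ⟧

    degSum : List V → List V → ℕ
    degSum U W = ∑ U (deg W)

    -- Lists stand for vertex sets. The remainder `W′` makes `xs` a part of `W`, so distinctness of
    -- the vertices of a path need not be carried along; it follows later from the uniqueness of the
    -- list of neighbours.
    PathFree : ℕ → List V → Set
    PathFree p W = ∀ {u v xs W′} → Walk u v xs → xs ++ W′ ↭ W → length xs ≢ p

    pathFree-++ : ∀ {p S W′ W} → S ++ W′ ↭ W → PathFree p W → PathFree p W′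
    pathFree-++ {S = S} {W′} S++W′↭W free {xs = xs} {W″} p xs↭ = free p
      (↭-trans (↭-reflexive (sym (++-assoc xs W″ S)))
        (↭-trans (Perm.++⁺ʳ S xs↭) (↭-trans (Perm.++-comm W′ S) S++W′↭W)))

    -- Count, over consecutive a, b along the walk, the edges x b and z a: at
    -- most one per step unless some step carries both.
    crossing : ∀ {u v xs} x z → Walk u v xs →
               (∃₂ λ ys zs → ∃₂ λ a b → Walk u a ys × Walk b v zs × E x b × E z a × ys ++ zs ≡ xs)
               ⊎ suc (deg xs x + deg xs z) ≤ length xs + (⟦ E? x u ⟧ + ⟦ E? z v ⟧)
    -- The two indicators on the right are boundary terms: the first vertex is never the `b` of a
    -- step and the last one never the `a`. When a vertex is put in front, the boundary term of `x`
    -- at the old first vertex becomes part of the new step.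
    crossing x z (single v) = inj₂ (≤-reflexive (lemma ⟦ E? x v ⟧ ⟦ E? z v ⟧))
      where
      lemma : ∀ a b → 1 + (a + 0 + (b + 0)) ≡ 1 + (a + b)
      lemma = solve-∀
    crossing {u} {v} x z (_∷_ {v = w} {xs = xs} uw p) with E? x w | E? z u | crossing x z p
    ... | _ | _ | inj₁ (ys , zs , a , b , p₁ , p₂ , xb , za , refl) =
      inj₁ (u ∷ ys , zs , a , b , uw ∷ p₁ , p₂ , xb , za , refl)
    ... | yes xw | yes zu | inj₂ _ =
      inj₁ (u ∷ [] , xs , u , w , single u , p , xw , zu , refl)
    ... | yes _ | no _ | inj₂ le = inj₂ (begin
        suc (⟦ E? x u ⟧ + deg xs x + (0 + deg xs z)) ≡⟨ lemma₁ ⟦ E? x u ⟧ (deg xs x) (deg xs z) ⟩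
        ⟦ E? x u ⟧ + suc (deg xs x + deg xs z)       ≤⟨ +-monoʳ-≤ ⟦ E? x u ⟧ le ⟩
        ⟦ E? x u ⟧ + (length xs + (1 + ⟦ E? z v ⟧))  ≡⟨ lemma₂ ⟦ E? x u ⟧ (length xs) ⟦ E? z v ⟧ ⟩
        suc (length xs) + (⟦ E? x u ⟧ + ⟦ E? z v ⟧)  ∎)
      where
      open ≤-Reasoning
      lemma₁ : ∀ a b c → 1 + (a + b + (0 + c)) ≡ a + suc (b + c)
      lemma₁ = solve-∀
      lemma₂ : ∀ a b c → a + (b + (1 + c)) ≡ suc b + (a + c)
      lemma₂ = solve-∀
    ... | no _ | zu? | inj₂ le = inj₂ (begin
        suc (⟦ E? x u ⟧ + deg xs x + (⟦ zu? ⟧ + deg xs z)) 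
          ≤⟨ s≤s (+-monoʳ-≤ (⟦ E? x u ⟧ + deg xs x) (+-monoˡ-≤ (deg xs z) (⟦⟧≤1 zu?))) ⟩
        suc (⟦ E? x u ⟧ + deg xs x + (1 + deg xs z)) ≡⟨ lemma₁ ⟦ E? x u ⟧ (deg xs x) (deg xs z) ⟩
        suc (⟦ E? x u ⟧ + suc (deg xs x + deg xs z)) ≤⟨ s≤s (+-monoʳ-≤ ⟦ E? x u ⟧ le) ⟩
        suc (⟦ E? x u ⟧ + (length xs + (0 + ⟦ E? z v ⟧))) ≡⟨ lemma₂ ⟦ E? x u ⟧ (length xs) ⟦ E? z v ⟧ ⟩
        suc (length xs) + (⟦ E? x u ⟧ + ⟦ E? z v ⟧)  ∎)
      where
      open ≤-Reasoning
      lemma₁ : ∀ a b c → 1 + (a + b + (1 + c)) ≡ 1 + (a + suc (b + c))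
      lemma₁ = solve-∀
      lemma₂ : ∀ a b c → 1 + (a + (b + (0 + c))) ≡ suc b + (a + c)
      lemma₂ = solve-∀

    degSum-++ : ∀ S W → degSum (S ++ W) (S ++ W) ≡ degSum S S + degSum S W + (degSum W S + degSum W W)
    degSum-++ S W = trans (∑-++ S W) (cong₂ _+_ (split-deg S) (split-deg W))
      where
      split-deg : ∀ U → degSum U (S ++ W) ≡ degSum U S + degSum U W
      split-deg U = trans (∑-cong U λ _ → ∑-++ S W) (∑-+ U)

    degSum-↭ : ∀ {U W} → U ↭ W → degSum U U ≡ degSum W W
    degSum-↭ {U} U↭W = trans (∑-cong U λ _ → ∑-↭ U↭W) (∑-↭ U↭W)

    degSum-sym : ∀ U W → degSum U W ≡ degSum W U
    degSum-sym U W = trans (∑-swap U W) (∑-cong W λ _ → ∑-cong U λ _ → E?-sym _ _)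
      where
      E?-sym : ∀ u w → ⟦ E? u w ⟧ ≡ ⟦ E? w u ⟧
      E?-sym u w with E? w u
      ... | yes wu = ⟦⟧-yes (E? u w) (E-sym wu)
      ... | no ¬wu = ⟦⟧-no (E? u w) λ uw → ¬wu (E-sym uw)

    deg<length : ∀ {S v} → v ∈ S → deg S v < length S
    deg<length {S} {v} v∈S with S′ , S↭ ← ∈⇒↭ v∈S = begin-strict
      deg S v                 ≡⟨ ∑-↭ S↭ ⟩
      ⟦ E? v v ⟧ + deg S′ v   ≡⟨ cong (_+ deg S′ v) (⟦⟧-no (E? v v) E-irrefl) ⟩
      deg S′ v                ≤⟨ ∑-mono S′ (λ _ → ⟦⟧≤1 (E? v _)) ⟩
      ∑ S′ (λ _ → 1)          ≡⟨ ∑-const S′ 1 ⟩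
      length S′ * 1           ≡⟨ *-identityʳ _ ⟩
      length S′               <⟨ ≤-refl ⟩
      length (v ∷ S′)         ≡⟨ Perm.↭-length S↭ ⟨
      length S                ∎
      where open ≤-Reasoning

    module _ (q : ℕ) where

      -- `S` is a nonempty union of connected components. With at most `q + 1` vertices, all degrees
      -- inside it are at most `q`, so it can be split off in the induction for `erdősGallai`.
      Component : List V → Set
      Component W = ∃₂ λ S W′ → S ++ W′ ↭ W × 0 < length S × length S ≤ suc q ×
                                (∀ {s w} → s ∈ S → w ∈ W′ → ¬ E s w)

      module _ {W : List V} (free : PathFree (2 + q) W)
               (dense : ∀ {w} → w ∈ W → suc q ≤ 2 * deg W w) where

        -- Unless an end vertex has a neighbour outside xs, both ends have all
        -- their neighbours in xs and crossing yields a cycle on xs; any edge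
        -- leaving that cycle then gives a longer path.
        grow : ∀ m {u v xs W′} → Walk u v xs → xs ++ W′ ↭ W → length xs + m ≡ 2 + q → Component W
        extend : ∀ m {u v w xs ys W′} → Walk u v ys → ys ↭ xs → E u w → w ∈ W′ →
                 xs ++ W′ ↭ W → length xs + suc m ≡ 2 + q → Component W

        extend m {w = w} {xs} {ys} {W′} p ys↭xs uw w∈W′ xs↭ len
          with W″ , W′↭ ← ∈⇒↭ w∈W′ =
          grow m (E-sym uw ∷ p)
            (↭-trans (↭-prep w (Perm.++⁺ʳ W″ ys↭xs))
              (↭-trans (↭-sym (Perm.shift w xs W″))
                (↭-trans (Perm.++⁺ˡ xs (↭-sym W′↭)) xs↭)))
            (trans (cong (λ l → suc (l + m)) (Perm.↭-length ys↭xs)) (trans (sym (+-suc _ m)) len))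

        -- `m` is the number of vertices still missing from the forbidden length `2 + q`.
        grow zero p xs↭ len = contradiction (trans (sym (+-identityʳ _)) len) (free p xs↭)
        grow (suc m) {u} {v} {xs} {W′} p xs↭ len with any? (λ c → any? (E? c) W′) xs
        ... | no ¬leaving = xs , W′ , xs↭ , length>0 p , m+1+n≡1+o⇒m≤o len ,
                            λ s∈ w∈ sw → ¬leaving (lose s∈ (lose w∈ sw))
        ... | yes leaving with any? (E? u) W′ | any? (E? v) W′
        ...   | yes uW′ | _ with w , w∈ , uw ← find uW′ = extend m p ↭-refl uw w∈ xs↭ len
        grow (suc m) p xs↭ len | yes leaving | no _ | yes vW′
          with w , w∈ , vw ← find vW′ | ys , p′ , ys↭ ← reverseWalk E-sym p =
          extend m p′ ys↭ vw w∈ xs↭ len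
        grow (suc m) {u} {v} {xs} {W′} p xs↭ len | yes leaving | no ¬uW′ | no ¬vW′
          with crossing u v p
        ... | inj₁ (ys , zs , a , b , p₁ , p₂ , ub , va , refl)
          with cs , cyc , ub′ , cs↭ ← closeUp E-sym p₁ p₂ ub va
             | c , c∈ , cW′ ← find leaving
          with w , w∈ , cw ← find cW′
             | _ , ds , p′ , ds↭ ← rotate cyc ub′ (Perm.∈-resp-↭ (↭-sym cs↭) c∈) =
          extend m p′ (↭-trans ds↭ cs↭) cw w∈ xs↭ len
        -- Without a crossing, the degrees of the two ends inside `xs` sum to less than `length xs`,
        -- hence to less than `q + 1`, since the boundary terms of `crossing` are now loops. By
        -- density each of the two degrees is at least half of `q + 1`.
        ... | inj₂ le = contradiction (begin-strict
            2 * suc q                                  ≡⟨ double (suc q) ⟩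
            suc q + suc q                              ≤⟨ +-mono-≤ (end (head∈ p) ¬uW′) (end (last∈ p) ¬vW′) ⟩
            2 * deg xs u + 2 * deg xs v                ≡⟨ *-distribˡ-+ 2 (deg xs u) (deg xs v) ⟨
            2 * (deg xs u + deg xs v)                  <⟨ *-monoʳ-< 2 le ⟩
            2 * (length xs + (⟦ E? u u ⟧ + ⟦ E? v v ⟧))
              ≡⟨ cong₂ (λ i j → 2 * (length xs + (i + j))) (⟦⟧-no (E? u u) E-irrefl) (⟦⟧-no (E? v v) E-irrefl) ⟩
            2 * (length xs + 0)                        ≤⟨ *-monoʳ-≤ 2 (≤-trans (≤-reflexive (+-identityʳ _)) (m+1+n≡1+o⇒m≤o len)) ⟩
            2 * suc q ∎) (<-irrefl refl)
          where
          open ≤-Reasoning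
          double : ∀ n → 2 * n ≡ n + n
          double = solve-∀
          end : ∀ {x} → x ∈ xs → ¬ Any (E x) W′ → suc q ≤ 2 * deg xs x
          end {x} x∈ ¬xW′ = subst (λ d → suc q ≤ 2 * d) (trans (sym (∑-↭ xs↭)) (trans (∑-++ xs W′)
              (trans (cong (deg xs x +_) (∑-zero W′ λ w∈ → ⟦⟧-no (E? x _) λ xw → ¬xW′ (lose w∈ xw)))
                     (+-identityʳ _))))
            (dense (Perm.∈-resp-↭ xs↭ (∈-++⁺ˡ x∈)))

      -- Induction on the number of vertices. Deleting a vertex lowers the degree sum by twice its
      -- degree, which is affordable if that is at most `q`. If there is no such vertex, `grow`
      -- finds a small component, and this is split off instead.
      erdősGallai : ∀ {W} → PathFree (2 + q) W → degSum W W ≤ length W * q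
      erdősGallai {W} = bound (length W) W ≤-refl
        where
        open ≤-Reasoning
        bound : ∀ m W → length W ≤ m → PathFree (2 + q) W → degSum W W ≤ length W * q
        bound m [] _ _ = z≤n
        bound (suc m) W@(v₀ ∷ W₀) (s≤s len) free with any? (λ v → 2 * deg W v ≤? q) W
        ... | yes low with v , v∈ , dv≤ ← find low
          with W′ , W↭ ← ∈⇒↭ v∈ = begin
            degSum W W ≡⟨ degSum-↭ W↭ ⟩
            degSum (v ∷ W′) (v ∷ W′)
              ≡⟨ degSum-++ [ v ] W′ ⟩
            degSum [ v ] [ v ] + degSum [ v ] W′ + (degSum W′ [ v ] + degSum W′ W′)
              ≡⟨ cong (λ d → degSum [ v ] [ v ] + degSum [ v ] W′ + (d + degSum W′ W′)) (degSum-sym W′ [ v ]) ⟩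
            degSum [ v ] [ v ] + degSum [ v ] W′ + (degSum [ v ] W′ + degSum W′ W′)
              ≡⟨ arith₁ ⟦ E? v v ⟧ (deg W′ v) (degSum W′ W′) ⟩
            ⟦ E? v v ⟧ + 2 * deg W′ v + degSum W′ W′
              -- Doubling the indicator of the loop at `v` completes the expression to twice the
              -- degree of `v` in all of `W`, the quantity that `dv≤` bounds.
              ≤⟨ +-monoˡ-≤ (degSum W′ W′) (+-monoˡ-≤ (2 * deg W′ v) (m≤n*m ⟦ E? v v ⟧ 2)) ⟩
            2 * ⟦ E? v v ⟧ + 2 * deg W′ v + degSum W′ W′
              ≡⟨ cong (_+ degSum W′ W′) (*-distribˡ-+ 2 ⟦ E? v v ⟧ (deg W′ v)) ⟨
            2 * deg (v ∷ W′) v + degSum W′ W′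
              ≡⟨ cong (λ d → 2 * d + degSum W′ W′) (∑-↭ {f = λ w → ⟦ E? v w ⟧} W↭) ⟨
            2 * deg W v + degSum W′ W′
              ≤⟨ +-mono-≤ dv≤ (bound m W′ len′ (pathFree-++ {S = [ v ]} (↭-sym W↭) free)) ⟩
            length (v ∷ W′) * q
              ≡⟨ cong (_* q) (Perm.↭-length W↭) ⟨
            length W * q ∎
          where
          arith₁ : ∀ a b c → a + 0 + 0 + (b + 0) + (b + 0 + c) ≡ a + 2 * b + c
          arith₁ = solve-∀
          len′ : length W′ ≤ m
          len′ = s≤s⁻¹ (subst (_≤ suc m) (Perm.↭-length W↭) (s≤s len))
        ... | no ¬low
          with S , W′ , S↭ , S>0 , S≤ , apart ←
               grow free (λ w∈ → ≰⇒> λ le → ¬low (lose w∈ le)) (suc q) (single v₀) ↭-refl refl = begin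
            degSum W W ≡⟨ degSum-↭ S↭ ⟨
            degSum (S ++ W′) (S ++ W′) ≡⟨ degSum-++ S W′ ⟩
            degSum S S + degSum S W′ + (degSum W′ S + degSum W′ W′)
              ≡⟨ cong (λ d → degSum S S + degSum S W′ + (d + degSum W′ W′)) (degSum-sym W′ S) ⟩
            degSum S S + degSum S W′ + (degSum S W′ + degSum W′ W′)
              ≡⟨ cong (λ d → degSum S S + d + (d + degSum W′ W′)) cross ⟩
            degSum S S + 0 + degSum W′ W′
              ≡⟨ cong (_+ degSum W′ W′) (+-identityʳ _) ⟩
            degSum S S + degSum W′ W′
              ≤⟨ +-mono-≤ within (bound m W′ len′ (pathFree-++ {S = S} S↭ free)) ⟩
            length S * q + length W′ * q
              ≡⟨ *-distribʳ-+ q (length S) (length W′) ⟨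
            (length S + length W′) * q
              ≡⟨ cong (_* q) lengths ⟩
            length W * q ∎
          where
          lengths : length S + length W′ ≡ length W
          lengths = trans (sym (length-++ S)) (Perm.↭-length S↭)
          len′ : length W′ ≤ m
          len′ = s≤s⁻¹ (≤-trans (+-monoˡ-≤ (length W′) S>0) (≤-trans (≤-reflexive lengths) (s≤s len)))
          cross : degSum S W′ ≡ 0
          cross = ∑-zero S λ s∈ → ∑-zero W′ λ w∈ → ⟦⟧-no (E? _ _) (apart s∈ w∈)
          within : degSum S S ≤ length S * q
          within = ≤-trans (∑-mono S λ s∈ → s≤s⁻¹ (≤-trans (deg<length s∈) S≤))
                           (≤-reflexive (∑-const S q))

  -- Kőnig's theorem

  Unique-resp-↭ : ∀ {A : Set} {xs ys : List A} → xs ↭ ys → Unique xs → Unique ys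
  Unique-resp-↭ xs↭ys = Permₛ.Unique-resp-↭ (setoid _) (↭⇒↭ₛ xs↭ys)

  Unique-++⁻ˡ : ∀ {A : Set} (xs : List A) {ys} → Unique (xs ++ ys) → Unique xs
  Unique-++⁻ˡ []       _        = []
  Unique-++⁻ˡ (x ∷ xs) (x∉ ∷ u) = Allₚ.++⁻ˡ xs x∉ ∷ Unique-++⁻ˡ xs u

  map-++-insert : ∀ {A B : Set} (f : A → B) ws ms {ns ns′ z} → map f ns′ ↭ z ∷ map f ns →
                  ws ++ map f (ms ++ ns′) ↭ z ∷ ws ++ map f (ms ++ ns)
  map-++-insert f ws ms {ns} {ns′} {z} ns′↭ =
    ↭-trans (Perm.++⁺ˡ ws (↭-trans (↭-reflexive (map-++ f ms ns′))
              (↭-trans (Perm.++⁺ˡ (map f ms) ns′↭)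
                (↭-trans (Perm.shift z (map f ms) (map f ns))
                         (↭-prep z (↭-reflexive (sym (map-++ f ms ns))))))))
            (Perm.shift z ws _)

  module Kőnig {X Y : Set} (_≟ʸ_ : DecidableEquality Y)
               (search : ∀ {P : Y → Set} → Decidable P → Dec (∃ P))
               {N : X → Y → Set} (N? : ∀ x y → Dec (N x y)) where

    open DecMembership _≟ʸ_ using () renaming (_∈?_ to _∈ʸ?_)

    Pairing : Set
    Pairing = List (X × Y)

    sources : Pairing → List X
    sources = map proj₁

    targets : Pairing → List Y
    targets = map proj₂

    Incident : Pairing → Set
    Incident = All (uncurry N)

    -- The sources of M₂ together with the targets of M₁ form a vertex
    -- cover of the incidence graph, of the same size as M₁ ++ M₂.
    record Decomposition (xs : List X) : Set where
      field
        U        : List X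
        M₁ M₂    : Pairing
        sources↭ : xs ↭ U ++ sources (M₁ ++ M₂)
        distinct : Unique (targets (M₁ ++ M₂))
        incident : Incident (M₁ ++ M₂)
        closed   : ∀ {x y} → x ∈ U ++ sources M₁ → N x y → y ∈ targets M₁

    module _ {xs : List X} (D : Decomposition xs) (x : X) where
      open Decomposition D

      -- M′ rematches x and the sources of R, leaving out r, to the targets of R.
      Reachable : Pairing → X → Set
      Reachable R r = ∃ λ M′ → r ∷ sources M′ ↭ x ∷ sources R × targets M′ ↭ targets R × Incident M′

      incident₂ : Incident M₂
      incident₂ = Allₚ.++⁻ʳ M₁ incident

      -- The new source `b` is freed by handing `y` over to `r` in the rematching that leaves out
      -- `r`. A source reached earlier keeps its rematching, with the pair of `b` and `y` added
      -- unchanged.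
      reach : ∀ {R r b y} → Reachable R r → N r y → N b y →
              (∀ {a} → a ∈ x ∷ sources R → Reachable R a) →
              ∀ {a} → a ∈ x ∷ sources ((b , y) ∷ R) → Reachable ((b , y) ∷ R) a
      reach {R} {r} {b} {y} (M′ , s↭ , t↭ , inc) ry by old a∈ with Perm.∈-resp-↭ (↭-swap x b ↭-refl) a∈
      ... | here refl = (r , y) ∷ M′ , ↭-trans (↭-prep b s↭) (↭-swap b x ↭-refl) ,
                        ↭-prep y t↭ , ry ∷ inc
      ... | there a∈′ with M″ , s↭ , t↭ , inc ← old a∈′ =
        (b , y) ∷ M″ , ↭-trans (↭-swap _ b ↭-refl) (↭-trans (↭-prep b s↭) (↭-swap b x ↭-refl)) ,
        ↭-prep y t↭ , by ∷ inc

      -- Search for an augmenting path from `x`: `R` is the explored part of `M₂`, `M′` the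
      -- unexplored part, and `m` bounds the number of remaining rounds. Targets of `M₁` are
      -- skipped, since by `closed` an alternating path that enters `M₁` can never leave it.
      alternate : ∀ m R M′ → length M′ ≤ m → R ++ M′ ↭ M₂ →
                  (∀ {r} → r ∈ x ∷ sources R → Reachable R r) → Decomposition (x ∷ xs)
      alternate m R M′ len R++M′↭ reachable
        with search (λ y → any? (λ r → N? r y) (x ∷ sources R) ×-dec ¬? (y ∈ʸ? targets (R ++ M₁)))
      -- No augmenting path: `x` stays unmatched, and the explored pairs change sides, because their
      -- targets together with those of `M₁` now contain all neighbours of `x` and of the explored
      -- sources.
      ... | no stuck = record
        { U        = x ∷ U
        ; M₁       = R ++ M₁
        ; M₂       = M′
        ; sources↭ = ↭-prep x (↭-trans sources↭ (Perm.++⁺ˡ U (Perm.map⁺ proj₁ (↭-sym regroup))))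
        ; distinct = Unique-resp-↭ (Perm.map⁺ proj₂ (↭-sym regroup)) distinct
        ; incident = Perm.All-resp-↭ (↭-sym regroup) incident
        ; closed   = closed′
        }
        where
        regroup : (R ++ M₁) ++ M′ ↭ M₁ ++ M₂
        regroup = ↭-trans (Perm.++⁺ʳ M′ (Perm.++-comm R M₁))
                  (↭-trans (↭-reflexive (++-assoc M₁ R M′)) (Perm.++⁺ˡ M₁ R++M′↭))
        from-R : ∀ {r y} → r ∈ x ∷ sources R → N r y → y ∈ targets (R ++ M₁)
        from-R {y = y} r∈ ry =
          decidable-stable (y ∈ʸ? _) λ y∉ → stuck (y , lose r∈ ry , y∉)
        from-old : ∀ {r y} → r ∈ U ++ sources M₁ → N r y → y ∈ targets (R ++ M₁)
        from-old r∈ ry = subst (_ ∈_) (sym (map-++ proj₂ R M₁)) (∈-++⁺ʳ (targets R) (closed r∈ ry))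
        closed′ : ∀ {r y} → r ∈ x ∷ U ++ sources (R ++ M₁) → N r y → y ∈ targets (R ++ M₁)
        closed′ (here refl) = from-R (here refl)
        closed′ (there r∈) with ∈-++⁻ U r∈
        ... | inj₁ r∈U = from-old (∈-++⁺ˡ r∈U)
        ... | inj₂ r∈M with ∈-++⁻ (sources R) (subst (_ ∈_) (map-++ proj₁ R M₁) r∈M)
        ...   | inj₁ r∈R  = from-R (there r∈R)
        ...   | inj₂ r∈M₁ = from-old (∈-++⁺ʳ U r∈M₁)
      ... | yes (y , ry? , y∉) with r , r∈ , ry ← find ry? with y ∈ʸ? targets M′
      -- The partner `b` of `y` becomes reachable, and their pair moves from `M′` to `R`.
      ...   | yes y∈M′
        with (b , _) , b∈ , refl ← ∈-map⁻ proj₂ y∈M′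
        with M″ , M′↭ ← ∈⇒↭ b∈ = continue m len
        where
        by : N b y
        by = All.lookup incident₂ (Perm.∈-resp-↭ R++M′↭ (∈-++⁺ʳ R b∈))
        continue : ∀ m → length M′ ≤ m → Decomposition (x ∷ xs)
        continue m len with subst (_≤ m) (Perm.↭-length M′↭) len
        continue (suc m) _ | s≤s len′ = alternate m ((b , y) ∷ R) M″ len′
          (↭-trans (↭-sym (Perm.shift _ R M″)) (↭-trans (Perm.++⁺ˡ R (↭-sym M′↭)) R++M′↭))
          (reach (reachable r∈) ry by reachable)
      -- Here `y` is unmatched, so the path is augmenting: `x` and the explored sources are
      -- rematched without `r`, and `r` receives `y`. The closed side `U`, `M₁` is untouched.
      alternate m R M′ len R++M′↭ reachable | yes (y , ry? , y∉) | no y∉M′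
        with Mᵣ , s↭ , t↭ , inc ← reachable r∈ = record
        { U        = U
        ; M₁       = M₁
        ; M₂       = (r , y) ∷ Mᵣ ++ M′
        ; sources↭ = ↭-trans (↭-prep x sources↭) (↭-sym (map-++-insert proj₁ U M₁ (rematch proj₁ s↭)))
        ; distinct = Unique-resp-↭ (↭-sym targets↭) (Allₚ.¬Any⇒All¬ _ y∉M ∷ distinct)
        ; incident = Allₚ.++⁺ (Allₚ.++⁻ˡ M₁ incident)
                       (ry ∷ Allₚ.++⁺ inc (Allₚ.++⁻ʳ R (Perm.All-resp-↭ (↭-sym R++M′↭) incident₂)))
        ; closed   = closed
        }
        where
        rematch : ∀ {B : Set} (f : X × Y → B) {z} → f (r , y) ∷ map f Mᵣ ↭ z ∷ map f R →
                  map f ((r , y) ∷ Mᵣ ++ M′) ↭ z ∷ map f M₂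
        rematch f {z} f↭ =
          ↭-trans (↭-reflexive (cong (f (r , y) ∷_) (map-++ f Mᵣ M′)))
          (↭-trans (Perm.++⁺ʳ (map f M′) f↭)
          (↭-prep z (↭-trans (↭-reflexive (sym (map-++ f R M′))) (Perm.map⁺ f R++M′↭))))
        targets↭ : targets (M₁ ++ (r , y) ∷ Mᵣ ++ M′) ↭ y ∷ targets (M₁ ++ M₂)
        targets↭ = map-++-insert proj₂ [] M₁ (rematch proj₂ (↭-prep y t↭))
        y∉M : y ∉ targets (M₁ ++ M₂)
        y∉M y∈ with ∈-++⁻ (targets M₁) (subst (y ∈_) (map-++ proj₂ M₁ M₂) y∈)
        ... | inj₁ y∈M₁ = y∉ (subst (y ∈_) (sym (map-++ proj₂ R M₁)) (∈-++⁺ʳ (targets R) y∈M₁))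
        ... | inj₂ y∈M₂ with ∈-++⁻ (targets R) (subst (y ∈_) (map-++ proj₂ R M′)
                               (Perm.∈-resp-↭ (Perm.map⁺ proj₂ (↭-sym R++M′↭)) y∈M₂))
        ...   | inj₁ y∈R  = y∉ (subst (y ∈_) (sym (map-++ proj₂ R M₁)) (∈-++⁺ˡ y∈R))
        ...   | inj₂ y∈M′ = y∉M′ y∈M′

      extendDecomposition : Decomposition (x ∷ xs)
      extendDecomposition = alternate (length M₂) [] M₂ ≤-refl ↭-refl
        λ { (here refl) → [] , ↭-refl , ↭-refl , [] }

    decompose : ∀ xs → Decomposition xs
    decompose [] = record
      { U = [] ; M₁ = [] ; M₂ = [] ; sources↭ = ↭-refl ; distinct = [] ; incident = [] ; closed = λ () }
    decompose (x ∷ xs) = extendDecomposition (decompose xs) x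

  -- Pairs and triples in finite sets, copies and Berge copies

  ∣p∣≡1+∣p-x∣ : ∀ {n} {p : Subset n} {x} → x ∈ˢ p → ∣ p ∣ ≡ suc ∣ p - x ∣
  ∣p∣≡1+∣p-x∣ {p = inside ∷ p}  here       = cong (suc ∘ ∣_∣) (sym (p─⊥≡p p))
  ∣p∣≡1+∣p-x∣ {p = inside ∷ p}  (there x∈) = cong suc (∣p∣≡1+∣p-x∣ x∈)
  ∣p∣≡1+∣p-x∣ {p = outside ∷ p} (there x∈) = ∣p∣≡1+∣p-x∣ x∈

  x∈p-y⁻ : ∀ {n} {p : Subset n} {x} y → x ∈ˢ p - y → x ∈ˢ p × x ≢ y
  x∈p-y⁻ {p = p} {x} y x∈ = p─q⊆p p ⁅ y ⁆ x∈ , λ { refl → x∉ x∈ }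
    where
    x∉ : ∀ {n} {p : Subset n} {x} → ¬ x ∈ˢ p - x
    x∉ {p = _ ∷ p} {suc x} (there x∈) = x∉ x∈

  card-nonempty : ∀ {n k} {p : Subset n} → ∣ p ∣ ≡ suc k → ∃ λ x → x ∈ˢ p
  card-nonempty {n} {p = p} eq with nonempty? p
  ... | yes ne   = ne
  ... | no empty = contradiction (trans (sym eq) (trans (cong ∣_∣ (Empty-unique empty)) (∣⊥∣≡0 n))) λ ()

  card-empty : ∀ {n} {p : Subset n} {x} → ∣ p ∣ ≡ 0 → ¬ x ∈ˢ p
  card-empty ∣p∣≡0 x∈p = contradiction (trans (sym ∣p∣≡0) (∣p∣≡1+∣p-x∣ x∈p)) λ ()

  card-remove : ∀ {n k} {p : Subset n} {x} → ∣ p ∣ ≡ suc k → x ∈ˢ p → ∣ p - x ∣ ≡ k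
  card-remove eq x∈p = suc-injective (trans (sym (∣p∣≡1+∣p-x∣ x∈p)) eq)

  ∈-pairˡ : ∀ {n} (u v : Fin n) → u ∈ˢ pair u v
  ∈-pairˡ u v = x∈p∪q⁺ (inj₁ (x∈⁅x⁆ u))

  ∈-pairʳ : ∀ {n} (u v : Fin n) → v ∈ˢ pair u v
  ∈-pairʳ u v = x∈p∪q⁺ {p = ⁅ u ⁆} (inj₂ (x∈⁅x⁆ v))

  pair-⊆ : ∀ {n} {u v : Fin n} {p} → u ∈ˢ p → v ∈ˢ p → pair u v ⊆ p
  pair-⊆ u∈ v∈ w∈ with ∈-pair⁻ w∈
  ... | inj₁ refl = u∈
  ... | inj₂ refl = v∈

  pair-comm : ∀ {n} (u v : Fin n) → pair u v ≡ pair v u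
  pair-comm u v = ⊆-antisym (pair-⊆ (∈-pairʳ v u) (∈-pairˡ v u)) (pair-⊆ (∈-pairʳ u v) (∈-pairˡ u v))

  ∣pair-vv∣≢2 : ∀ {n} {v : Fin n} → ∣ pair v v ∣ ≢ 2
  ∣pair-vv∣≢2 {v = v} eq =
    contradiction (trans (sym eq) (trans (cong ∣_∣ (∪-idem ⁅ v ⁆)) (∣⁅x⁆∣≡1 v))) λ ()

  module _ {m n} (φ : Fin m → Fin n) where

    pair-map : ∀ {u v u′ v′} → pair u v ≡ pair u′ v′ → pair (φ u) (φ v) ≡ pair (φ u′) (φ v′)
    pair-map {u} {v} {u′} {v′} eq = ⊆-antisym
      (pair-⊆ (image (⊆-reflexive eq (∈-pairˡ u v))) (image (⊆-reflexive eq (∈-pairʳ u v))))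
      (pair-⊆ (image (⊆-reflexive (sym eq) (∈-pairˡ u′ v′))) (image (⊆-reflexive (sym eq) (∈-pairʳ u′ v′))))
      where
      image : ∀ {w u v} → w ∈ˢ pair u v → φ w ∈ˢ pair (φ u) (φ v)
      image {u = u} {v} w∈ with ∈-pair⁻ w∈
      ... | inj₁ refl = ∈-pairˡ (φ u) (φ v)
      ... | inj₂ refl = ∈-pairʳ (φ u) (φ v)

    pair-map⁻ : Injective _≡_ _≡_ φ → ∀ {u v u′ v′} →
                pair (φ u) (φ v) ≡ pair (φ u′) (φ v′) → pair u v ≡ pair u′ v′
    pair-map⁻ inj {u} {v} {u′} {v′} eq = ⊆-antisym
      (pair-⊆ (preimage (⊆-reflexive eq (∈-pairˡ (φ u) (φ v))))
              (preimage (⊆-reflexive eq (∈-pairʳ (φ u) (φ v)))))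
      (pair-⊆ (preimage (⊆-reflexive (sym eq) (∈-pairˡ (φ u′) (φ v′))))
              (preimage (⊆-reflexive (sym eq) (∈-pairʳ (φ u′) (φ v′)))))
      where
      preimage : ∀ {w u v} → φ w ∈ˢ pair (φ u) (φ v) → w ∈ˢ pair u v
      preimage {u = u} {v} φw∈ with ∈-pair⁻ φw∈
      ... | inj₁ eq = subst (_∈ˢ pair u v) (sym (inj eq)) (∈-pairˡ u v)
      ... | inj₂ eq = subst (_∈ˢ pair u v) (sym (inj eq)) (∈-pairʳ u v)

  card2⇒pair : ∀ {n} {p : Subset n} → ∣ p ∣ ≡ 2 → ∃₂ λ u v → p ≡ pair u v
  card2⇒pair {p = p} eq
    with u , u∈p ← card-nonempty eq
    with v , v∈p-u ← card-nonempty (card-remove eq u∈p) =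
    u , v , ⊆-antisym p⊆ (pair-⊆ u∈p (proj₁ (x∈p-y⁻ u v∈p-u)))
    where
    p⊆ : p ⊆ pair u v
    p⊆ {w} w∈p with w ≟ᶠ u | w ≟ᶠ v
    ... | yes refl | _        = ∈-pairˡ u v
    ... | no _     | yes refl = ∈-pairʳ u v
    ... | no w≢u   | no w≢v   = contradiction (x∈p∧x≢y⇒x∈p-y (x∈p∧x≢y⇒x∈p-y w∈p w≢u) w≢v)
                                  (card-empty (card-remove (card-remove eq u∈p) v∈p-u))

  -- Removing the three vertices from a set of size 3 leaves nothing, so every element of one set is
  -- one of the three and thus lies in the other.
  card3-unique : ∀ {n} {e e′ : Subset n} {u v w} → ∣ e ∣ ≡ 3 → ∣ e′ ∣ ≡ 3 →
                 u ∈ˢ e × v ∈ˢ e - u × w ∈ˢ e - u - v →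
                 u ∈ˢ e′ × v ∈ˢ e′ - u × w ∈ˢ e′ - u - v → e ≡ e′
  card3-unique eq eq′ t t′ = ⊆-antisym (covered eq t t′) (covered eq′ t′ t)
    where
    covered : ∀ {n} {e e′ : Subset n} {u v w} → ∣ e ∣ ≡ 3 →
              u ∈ˢ e × v ∈ˢ e - u × w ∈ˢ e - u - v →
              u ∈ˢ e′ × v ∈ˢ e′ - u × w ∈ˢ e′ - u - v → e ⊆ e′
    covered {u = u} {v} {w} eq (u∈ , v∈ , w∈) (u∈′ , v∈′ , w∈′) {z} z∈
      with z ≟ᶠ u | z ≟ᶠ v | z ≟ᶠ w
    ... | yes refl | _ | _ = u∈′
    ... | no _ | yes refl | _ = proj₁ (x∈p-y⁻ u v∈′)
    ... | no _ | no _ | yes refl = proj₁ (x∈p-y⁻ u (proj₁ (x∈p-y⁻ v w∈′)))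
    ... | no z≢u | no z≢v | no z≢w =
      contradiction (x∈p∧x≢y⇒x∈p-y (x∈p∧x≢y⇒x∈p-y (x∈p∧x≢y⇒x∈p-y z∈ z≢u) z≢v) z≢w)
                    (card-empty (card-remove (card-remove (card-remove eq u∈) v∈) w∈))

  ∑-∈ˢ : ∀ {n} (p : Subset n) → ∑ (allFin n) (λ x → ⟦ x ∈ˢ? p ⟧) ≡ ∣ p ∣
  ∑-∈ˢ {n} p = trans (cong sum (map-tabulate id (λ x → ⟦ x ∈ˢ? p ⟧))) (count p)
    where
    count : ∀ {n} (p : Subset n) → sum (tabulate λ x → ⟦ x ∈ˢ? p ⟧) ≡ ∣ p ∣
    count []            = refl
    count (inside ∷ p)  = cong suc (count p)
    count (outside ∷ p) = count p

  ∑-∈ˢ-const : ∀ {n} (p : Subset n) {f : Fin n → ℕ} {c} → (∀ {x} → x ∈ˢ p → f x ≡ c) →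
               ∑ (allFin n) (λ x → ⟦ x ∈ˢ? p ⟧ * f x) ≡ ∣ p ∣ * c
  ∑-∈ˢ-const {n} p {f} {c} f≡c = begin
    ∑ (allFin n) (λ x → ⟦ x ∈ˢ? p ⟧ * f x) ≡⟨ ∑-cong (allFin n) (λ {x} _ → replace (x ∈ˢ? p)) ⟩
    ∑ (allFin n) (λ x → c * ⟦ x ∈ˢ? p ⟧)   ≡⟨ ∑-* (allFin n) c ⟩
    c * ∑ (allFin n) (λ x → ⟦ x ∈ˢ? p ⟧)   ≡⟨ cong (c *_) (∑-∈ˢ p) ⟩
    c * ∣ p ∣                              ≡⟨ *-comm c ∣ p ∣ ⟩
    ∣ p ∣ * c                              ∎
    where
    open ≡-Reasoning
    replace : ∀ {x} (x∈? : Dec (x ∈ˢ p)) → ⟦ x∈? ⟧ * f x ≡ c * ⟦ x∈? ⟧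
    replace (yes x∈p) = trans (*-identityˡ _) (trans (f≡c x∈p) (sym (*-identityʳ c)))
    replace (no _)    = sym (*-zeroʳ c)

  -- Distinctness is expressed by successive removal, so each choice has one candidate fewer than
  -- the one before. This is the source of the constants 2 for pairs and 6 for hyperedges.
  orderedPairs : ∀ {n k} {p : Subset n} → ∣ p ∣ ≡ suc k →
                 ∑ (allFin n) (λ x → ∑ (allFin n) λ y → ⟦ x ∈ˢ? p ⟧ * ⟦ y ∈ˢ? p - x ⟧) ≡ suc k * k
  orderedPairs {n} {k} {p} eq = begin
    ∑ (allFin n) (λ x → ∑ (allFin n) λ y → ⟦ x ∈ˢ? p ⟧ * ⟦ y ∈ˢ? p - x ⟧)
      ≡⟨ ∑-cong (allFin n) (λ {x} _ → ∑-* (allFin n) ⟦ x ∈ˢ? p ⟧) ⟩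
    ∑ (allFin n) (λ x → ⟦ x ∈ˢ? p ⟧ * ∑ (allFin n) λ y → ⟦ y ∈ˢ? p - x ⟧)
      ≡⟨ ∑-∈ˢ-const p (λ {x} x∈ → trans (∑-∈ˢ (p - x)) (card-remove eq x∈)) ⟩
    ∣ p ∣ * k ≡⟨ cong (_* k) eq ⟩
    suc k * k ∎
    where open ≡-Reasoning

  orderedTriples : ∀ {n k} {p : Subset n} → ∣ p ∣ ≡ 2 + k →
                   ∑ (allFin n) (λ x → ∑ (allFin n) λ y → ∑ (allFin n) λ z →
                     ⟦ x ∈ˢ? p ⟧ * (⟦ y ∈ˢ? p - x ⟧ * ⟦ z ∈ˢ? p - x - y ⟧))
                   ≡ (2 + k) * ((1 + k) * k)
  orderedTriples {n} {k} {p} eq = begin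
    ∑ (allFin n) (λ x → ∑ (allFin n) λ y → ∑ (allFin n) λ z →
      ⟦ x ∈ˢ? p ⟧ * (⟦ y ∈ˢ? p - x ⟧ * ⟦ z ∈ˢ? p - x - y ⟧))
      ≡⟨ ∑-cong (allFin n) (λ {x} _ → trans (∑-cong (allFin n) λ _ → ∑-* (allFin n) ⟦ x ∈ˢ? p ⟧)
                                            (∑-* (allFin n) ⟦ x ∈ˢ? p ⟧)) ⟩
    ∑ (allFin n) (λ x → ⟦ x ∈ˢ? p ⟧ * ∑ (allFin n) λ y → ∑ (allFin n) λ z →
      ⟦ y ∈ˢ? p - x ⟧ * ⟦ z ∈ˢ? p - x - y ⟧)
      ≡⟨ ∑-∈ˢ-const p (λ {x} x∈ → orderedPairs {p = p - x} (card-remove eq x∈)) ⟩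
    ∣ p ∣ * ((1 + k) * k) ≡⟨ cong (_* ((1 + k) * k)) eq ⟩
    (2 + k) * ((1 + k) * k) ∎
    where open ≡-Reasoning

  module _ {n} (G : Graph n) {E : Fin n → Fin n → Set} (E⇒edge : ∀ {u v} → E u v → pair u v ∈ edges G) where
    open Walks E

    -- Positions on a walk are described by `toℕ`, the form in which `toℕ-next` describes the
    -- successor on the cycle.
    walk-first : ∀ {u v xs} → Walk u v xs → ∀ j → toℕ j ≡ 0 → lookup xs j ≡ u
    walk-first (single _) zero _ = refl
    walk-first (_ ∷ _)    zero _ = refl

    walk-last : ∀ {u v xs} → Walk u v xs → ∀ i → suc (toℕ i) ≡ length xs → lookup xs i ≡ v
    walk-last (single _) zero    _  = refl
    walk-last (_ ∷ p)    zero    eq = contradiction (suc-injective eq) (<⇒≢ (length>0 p))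
    walk-last (_ ∷ p)    (suc i) eq = walk-last p i (suc-injective eq)

    walk-step : ∀ {u v xs} → Walk u v xs → ∀ i j → toℕ j ≡ suc (toℕ i) → E (lookup xs i) (lookup xs j)
    walk-step (single _) zero    zero    ()
    walk-step (uv ∷ p)   zero    (suc j) eq = subst (E _) (sym (walk-first p j (suc-injective eq))) uv
    walk-step (_ ∷ p)    (suc i) (suc j) eq = walk-step p i j (suc-injective eq)

    cycleCopy : ∀ {m} (m≥3 : m ≥ 3) {u v xs} → Walk u v xs → E v u → Unique xs → length xs ≡ m →
                Copy (C m m≥3) G
    cycleCopy m≥3 {xs = xs} p vu uniq refl = record
      { φ           = lookup xs
      ; φ-injective = lookup-injective uniq
      -- `pair a b` equals a cycle edge only as an unordered pair; `pair-map` carries the equality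
      -- over to the images without fixing an orientation.
      ; φ-edge      = λ a b ab∈ → let i , ab≡ = ∈-tabulate⁻ ab∈ in
                      subst (_∈ edges G) (sym (pair-map (lookup xs) ab≡)) (E⇒edge (step i))
      }
      where
      step : ∀ i → E (lookup xs i) (lookup xs (next i))
      step i with toℕ-next i
      ... | inj₁ eq          = walk-step p i (next i) eq
      ... | inj₂ (eq₀ , eq₁) = subst₂ E (sym (walk-last p i eq₁)) (sym (walk-first p (next i) eq₀)) vu

  map-unique⇒injective : ∀ {A B : Set} (f : A → B) {xs x y} → Unique (map f xs) →
                         x ∈ xs → y ∈ xs → f x ≡ f y → x ≡ y
  map-unique⇒injective f (x∉ ∷ u) (here refl) (here refl) eq = refl
  map-unique⇒injective f (x∉ ∷ u) (here refl) (there y∈)  eq = contradiction eq (All.lookup x∉ (∈-map⁺ f y∈))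
  map-unique⇒injective f (x∉ ∷ u) (there x∈)  (here refl) eq = contradiction (sym eq) (All.lookup x∉ (∈-map⁺ f x∈))
  map-unique⇒injective f (x∉ ∷ u) (there x∈)  (there y∈)  eq = map-unique⇒injective f u x∈ y∈ eq

  -- Each edge of the copy is sent to the hyperedge matched with its image. As the sources of `M`
  -- are distinct, a hyperedge determines its matched pair, and by injectivity of `φ` the pair
  -- determines the edge of `F`.
  copy⇒bergeCopy : ∀ {m n r} {F : Graph m} {G : Graph n} {H : Hypergraph r n}
                   (M : List (Subset n × Subset n)) → Unique (map proj₁ M) →
                   (∀ {e y} → (e , y) ∈ M → e ∈ edges H × y ⊆ e) →
                   (∀ {y} → y ∈ edges G → y ∈ map proj₂ M) →
                   Copy F G → BergeCopy F H
  copy⇒bergeCopy {F = F} {G} {H} M uniq sound covered c = record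
    { φ           = φ
    ; φ-injective = φ-injective
    ; f           = λ a → index (proj₁ (sound (matched a)))
    ; f-injective = λ {a} {b} eq → lookup-injective (unique F) (f-inj a b eq)
    ; f-edge      = λ a u v eq → subst₂ _⊆_ (pair-map φ (trans (sym (ends≡ a)) eq))
                                            (lookup-index (proj₁ (sound (matched a))))
                                            (proj₂ (sound (matched a)))
    }
    where
    open Copy c
    ends : ∀ a → ∃₂ λ u v → vertices F a ≡ pair u v
    ends a = card2⇒pair (All.lookup (uniform F) (∈-lookup a))
    ends≡ : ∀ a → vertices F a ≡ pair (proj₁ (ends a)) (proj₁ (proj₂ (ends a)))
    ends≡ a = proj₂ (proj₂ (ends a))
    image : Edge F → Subset _
    image a = pair (φ (proj₁ (ends a))) (φ (proj₁ (proj₂ (ends a))))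
    match : ∀ a → ∃ λ e → (e , image a) ∈ M
    match a with (e , _) , ey∈ , eq ←
      ∈-map⁻ proj₂ (covered (φ-edge _ _ (subst (_∈ edges F) (ends≡ a) (∈-lookup a)))) =
      e , subst (λ y → (e , y) ∈ M) (sym eq) ey∈
    matched : ∀ a → (proj₁ (match a) , image a) ∈ M
    matched a = proj₂ (match a)
    f-inj : ∀ a b → index (proj₁ (sound (matched a))) ≡ index (proj₁ (sound (matched b))) →
            vertices F a ≡ vertices F b
    f-inj a b eq = trans (ends≡ a) (trans (pair-map⁻ φ φ-injective image≡) (sym (ends≡ b)))
      where
      image≡ : image a ≡ image b
      image≡ = cong proj₂ (map-unique⇒injective proj₁ uniq (matched a) (matched b)
        (trans (lookup-index (proj₁ (sound (matched a))))
          (trans (cong (lookup (edges H)) eq) (sym (lookup-index (proj₁ (sound (matched b))))))))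

  -- Counting triangles

  module Triangles {n : ℕ} (B : List (Subset n)) (B-pairs : All (λ b → ∣ b ∣ ≡ 2) B) where

    V : List (Fin n)
    V = allFin n

    Adj : Fin n → Fin n → Set
    Adj u v = pair u v ∈ B

    adj? : ∀ u v → Dec (Adj u v)
    adj? u v = pair u v ∈? B

    adj-sym : ∀ {u v} → Adj u v → Adj v u
    adj-sym {u} {v} = subst (_∈ B) (pair-comm u v)

    adj-irrefl : ∀ {v} → ¬ Adj v v
    adj-irrefl {v} vv = ∣pair-vv∣≢2 {v = v} (All.lookup B-pairs vv)

    open ErdősGallai adj? adj-sym (λ {v} → adj-irrefl {v})

    neighbours : Fin n → List (Fin n)
    neighbours v = filter (adj? v) V

    -- Ordered triangles, so each one counts six times. For fixed `u` the first two factors restrict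
    -- `v` and `w` to the neighbours of `u`, and the last one counts ordered edges of the link of
    -- `u`.
    triangles : ℕ
    triangles = ∑ V λ u → ∑ V λ v → ∑ V λ w → ⟦ adj? u v ⟧ * (⟦ adj? u w ⟧ * ⟦ adj? v w ⟧)

    -- Handshaking: an adjacent ordered pair is charged to its unordered pair in `B`, which is
    -- charged only by its two orderings.
    ∑-neighbours : ∑ V (length ∘ neighbours) ≤ 2 * length B
    ∑-neighbours = begin
      ∑ V (length ∘ neighbours)
        ≡⟨ ∑-cong V (λ {u} _ → length-filter (adj? u) V) ⟩
      ∑ V (λ u → ∑ V λ v → ⟦ adj? u v ⟧)
        ≤⟨ ∑-mono V (λ {u} _ → ∑-mono V λ {v} _ → covered u v) ⟩
      ∑ V (λ u → ∑ V λ v → ∑ B λ b → inPair b u v)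
        ≡⟨ ∑-cong V (λ _ → ∑-swap V B) ⟩
      ∑ V (λ u → ∑ B λ b → ∑ V λ v → inPair b u v)
        ≡⟨ ∑-swap V B ⟩
      ∑ B (λ b → ∑ V λ u → ∑ V λ v → inPair b u v)
        ≡⟨ ∑-cong B (λ {b} b∈ → orderedPairs {p = b} (All.lookup B-pairs b∈)) ⟩
      ∑ B (λ _ → 2)
        ≡⟨ trans (∑-const B 2) (*-comm (length B) 2) ⟩
      2 * length B ∎
      where
      open ≤-Reasoning
      inPair : Subset n → Fin n → Fin n → ℕ
      inPair b u v = ⟦ u ∈ˢ? b ⟧ * ⟦ v ∈ˢ? b - u ⟧
      covered : ∀ u v → ⟦ adj? u v ⟧ ≤ ∑ B λ b → inPair b u v
      covered u v with adj? u v
      ... | no _   = z≤n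
      ... | yes uv = ≤-trans (≤-reflexive (sym one)) (∑-∋ (λ b → inPair b u v) uv)
        where
        v≢u : v ≢ u
        v≢u refl = adj-irrefl uv
        one : inPair (pair u v) u v ≡ 1
        one = cong₂ _*_ (⟦⟧-yes (u ∈ˢ? pair u v) (∈-pairˡ u v))
                        (⟦⟧-yes (v ∈ˢ? pair u v - u) (x∈p∧x≢y⇒x∈p-y (∈-pairʳ u v) v≢u))

    link-degSum : ∀ u → (∑ V λ v → ∑ V λ w → ⟦ adj? u v ⟧ * (⟦ adj? u w ⟧ * ⟦ adj? v w ⟧))
                        ≡ degSum (neighbours u) (neighbours u)
    link-degSum u = sym (begin
      degSum (neighbours u) (neighbours u)
        ≡⟨ ∑-filter (adj? u) V ⟩
      ∑ V (λ v → ⟦ adj? u v ⟧ * deg (neighbours u) v)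
        ≡⟨ ∑-cong V (λ {v} _ → cong (⟦ adj? u v ⟧ *_) (∑-filter (adj? u) V)) ⟩
      ∑ V (λ v → ⟦ adj? u v ⟧ * ∑ V λ w → ⟦ adj? u w ⟧ * ⟦ adj? v w ⟧)
        ≡⟨ ∑-cong V (λ {v} _ → ∑-* V ⟦ adj? u v ⟧) ⟨
      ∑ V (λ v → ∑ V λ w → ⟦ adj? u v ⟧ * (⟦ adj? u w ⟧ * ⟦ adj? v w ⟧)) ∎)
      where open ≡-Reasoning

    triangles-bound : ∀ q → (∀ u → PathFree (2 + q) (neighbours u)) → triangles ≤ q * (2 * length B)
    triangles-bound q free = begin
      triangles
        ≤⟨ ∑-mono V (λ {u} _ → ≤-trans (≤-reflexive (link-degSum u)) (≤-trans (erdősGallai q (free u))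
                                  (≤-reflexive (*-comm (length (neighbours u)) q)))) ⟩
      ∑ V (λ u → q * length (neighbours u)) ≡⟨ ∑-* V q ⟩
      q * ∑ V (length ∘ neighbours)         ≤⟨ *-monoʳ-≤ q ∑-neighbours ⟩
      q * (2 * length B)                    ∎
      where open ≤-Reasoning

    -- The six orderings of a hyperedge are ordered triangles by `shadow`, and an ordered triple
    -- determines the hyperedge it comes from.
    hyperedges≤triangles : ∀ {A : List (Subset n)} → Unique A → (∀ {e} → e ∈ A → ∣ e ∣ ≡ 3) →
                           (∀ {e u v} → e ∈ A → u ∈ˢ e → v ∈ˢ e → u ≢ v → Adj u v) →
                           6 * length A ≤ triangles
    hyperedges≤triangles {A} uniq card3 shadow = begin
      6 * length A
        ≡⟨ trans (*-comm 6 (length A)) (sym (∑-const A 6)) ⟩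
      ∑ A (λ _ → 6)
        ≡⟨ ∑-cong A (λ {e} e∈ → orderedTriples {p = e} (card3 e∈)) ⟨
      ∑ A (λ e → ∑ V λ u → ∑ V λ v → ∑ V λ w → inTriple e u v w)
        ≡⟨ ∑-swap A V ⟩
      ∑ V (λ u → ∑ A λ e → ∑ V λ v → ∑ V λ w → inTriple e u v w)
        ≡⟨ ∑-cong V (λ _ → trans (∑-swap A V) (∑-cong V λ _ → ∑-swap A V)) ⟩
      ∑ V (λ u → ∑ V λ v → ∑ V λ w → ∑ A λ e → inTriple e u v w)
        ≤⟨ ∑-mono V (λ {u} _ → ∑-mono V λ {v} _ → ∑-mono V λ {w} _ → pointwise u v w) ⟩
      triangles ∎
      where
      open ≤-Reasoning
      InTriple : Subset n → Fin n → Fin n → Fin n → Set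
      InTriple e u v w = u ∈ˢ e × v ∈ˢ e - u × w ∈ˢ e - u - v
      inTriple? : ∀ e u v w → Dec (InTriple e u v w)
      inTriple? e u v w = u ∈ˢ? e ×-dec (v ∈ˢ? e - u ×-dec w ∈ˢ? e - u - v)
      inTriple : Subset n → Fin n → Fin n → Fin n → ℕ
      inTriple e u v w = ⟦ u ∈ˢ? e ⟧ * (⟦ v ∈ˢ? e - u ⟧ * ⟦ w ∈ˢ? e - u - v ⟧)
      ⟦×××⟧ : {P Q R : Set} (P? : Dec P) (Q? : Dec Q) (R? : Dec R) →
              ⟦ P? ×-dec (Q? ×-dec R?) ⟧ ≡ ⟦ P? ⟧ * (⟦ Q? ⟧ * ⟦ R? ⟧)
      ⟦×××⟧ P? Q? R? = trans (⟦×⟧ P? (Q? ×-dec R?)) (cong (⟦ P? ⟧ *_) (⟦×⟧ Q? R?))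
      adjacent : ∀ {e u v w} → e ∈ A → InTriple e u v w → Adj u v × Adj u w × Adj v w
      adjacent {e} {u} {v} {w} e∈ (u∈ , v∈ , w∈)
        with v∈e , v≢u ← x∈p-y⁻ u v∈ | w∈e-u , w≢v ← x∈p-y⁻ v w∈
        with w∈e , w≢u ← x∈p-y⁻ u w∈e-u =
        shadow e∈ u∈ v∈e (v≢u ∘ sym) , shadow e∈ u∈ w∈e (w≢u ∘ sym) , shadow e∈ v∈e w∈e (w≢v ∘ sym)
      pointwise : ∀ u v w → ∑ A (λ e → inTriple e u v w) ≤ ⟦ adj? u v ⟧ * (⟦ adj? u w ⟧ * ⟦ adj? v w ⟧)
      pointwise u v w = begin
        ∑ A (λ e → inTriple e u v w)
          ≡⟨ ∑-cong A (λ {e} _ → ⟦×××⟧ (u ∈ˢ? e) (v ∈ˢ? e - u) (w ∈ˢ? e - u - v)) ⟨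
        ∑ A (λ e → ⟦ inTriple? e u v w ⟧)
          ≤⟨ ∑-atMostOne (λ e → inTriple? e u v w) (adj? u v ×-dec (adj? u w ×-dec adj? v w)) uniq
               (λ e∈ e′∈ → card3-unique (card3 e∈) (card3 e′∈)) adjacent ⟩
        ⟦ adj? u v ×-dec (adj? u w ×-dec adj? v w) ⟧
          ≡⟨ ⟦×××⟧ (adj? u v) (adj? u w) (adj? v w) ⟩
        ⟦ adj? u v ⟧ * (⟦ adj? u w ⟧ * ⟦ adj? v w ⟧) ∎

    -- Both ends of such a path are adjacent to `u`, so putting `u` in front closes it to a cycle
    -- with one more vertex. Since `u` is not its own neighbour, it does not lie on the path.
    links-pathFree : ∀ {q} (h : 3 + q ≥ 3) (G : Graph n) → (∀ {b} → b ∈ B → b ∈ edges G) →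
                     Free (C (3 + q) h) G → ∀ u → PathFree (2 + q) (neighbours u)
    links-pathFree h G B⊆G free u {x} {y} {xs} {W′} p xs↭ len =
      free (cycleCopy G B⊆G h (adj (head∈ p) ∷ p) (adj-sym (adj (last∈ p))) (u∉xs ∷ uniq) (cong suc len))
      where
      open Walks Adj
      adj : ∀ {x} → x ∈ xs → Adj u x
      adj x∈ = proj₂ (∈-filter⁻ (adj? u) {xs = V} (Perm.∈-resp-↭ xs↭ (∈-++⁺ˡ x∈)))
      u∉xs : All (u ≢_) xs
      u∉xs = Allₚ.¬Any⇒All¬ xs λ u∈ → adj-irrefl (adj u∈)
      uniq : Unique xs
      uniq = Unique-++⁻ˡ xs (Unique-resp-↭ (↭-sym xs↭) (Uniqueₚ.filter⁺ (adj? u) {xs = V} (Uniqueₚ.allFin⁺ n)))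

  -- From a Berge-cycle-free hypergraph to a cycle-free graph

  bergeFree⇒free : ∀ {n q} (q≥3 : q ≥ 3) (h : 3 + q ≥ 3) (H : Hypergraph 3 n) → BergeFree (C (3 + q) h) H →
                   ∃ λ (G : Graph n) → Free (C (3 + q) h) G × 3 * size H ≤ q * size G
  bergeFree⇒free {n} {q} q≥3 h H bergeFree = G , G-free , bound
    where
    Incidence : Subset n → Subset n → Set
    Incidence e y = ∣ y ∣ ≡ 2 × y ⊆ e

    open Kőnig _≟ˢ_ anySubset? {Incidence} (λ e y → (∣ y ∣ ≟ 2) ×-dec (y ⊆? e))
    open Decomposition (decompose (edges H))

    M : Pairing
    M = M₁ ++ M₂

    -- The blue pairs are the targets of `M₁` and the red ones those of `M₂`. `A` consists of the
    -- hyperedges that `closed` makes blue triangles; the remaining ones are the sources of `M₂`.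
    A : List (Subset n)
    A = U ++ sources M₁

    G : Graph n
    G = mkHypergraph (targets M) distinct (Allₚ.map⁺ (All.map proj₁ incident))

    sources⊆H : ∀ {e} → e ∈ U ++ sources M → e ∈ edges H
    sources⊆H = Perm.∈-resp-↭ (↭-sym sources↭)

    edges↭ : edges H ↭ A ++ sources M₂
    edges↭ = ↭-trans sources↭ (↭-reflexive
      (trans (cong (U ++_) (map-++ proj₁ M₁ M₂)) (sym (++-assoc U (sources M₁) (sources M₂)))))

    G-free : Free (C (3 + q) h) G
    G-free = bergeFree ∘ copy⇒bergeCopy M
      (Unique-++⁻ˡ (sources M) (Unique-resp-↭ (↭-trans sources↭ (Perm.++-comm U (sources M))) (unique H)))
      (λ ey∈ → sources⊆H (∈-++⁺ʳ U (∈-map⁺ proj₁ ey∈)) , proj₂ (All.lookup incident ey∈))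
      id

    open Triangles (targets M₁) (Allₚ.map⁺ (All.map proj₁ (Allₚ.++⁻ˡ M₁ incident)))

    A⊆H : ∀ {e} → e ∈ A → e ∈ edges H
    A⊆H e∈ = Perm.∈-resp-↭ (↭-sym edges↭) (∈-++⁺ˡ e∈)

    6A≤ : 6 * length A ≤ q * (2 * length M₁)
    6A≤ = begin
      6 * length A
        ≤⟨ hyperedges≤triangles (Unique-++⁻ˡ A (Unique-resp-↭ edges↭ (unique H)))
             (All.lookup (uniform H) ∘ A⊆H)
             (λ e∈ u∈ v∈ u≢v → closed e∈ (∣pair∣≡2 u≢v , pair-⊆ u∈ v∈)) ⟩
      triangles
        ≤⟨ triangles-bound q (links-pathFree h G
             (λ b∈ → subst (_ ∈_) (sym (map-++ proj₂ M₁ M₂)) (∈-++⁺ˡ b∈)) G-free) ⟩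
      q * (2 * length (targets M₁))
        ≡⟨ cong (λ l → q * (2 * l)) (length-map proj₂ M₁) ⟩
      q * (2 * length M₁) ∎
      where open ≤-Reasoning

    bound : 3 * size H ≤ q * size G
    bound = begin
      3 * size H
        ≡⟨ cong (3 *_) (trans (Perm.↭-length edges↭) (trans (length-++ A) (cong (length A +_) (length-map proj₁ M₂)))) ⟩
      3 * (length A + length M₂)
        ≡⟨ *-distribˡ-+ 3 (length A) (length M₂) ⟩
      3 * length A + 3 * length M₂
        ≤⟨ +-mono-≤ 3A≤ (*-monoˡ-≤ (length M₂) q≥3) ⟩
      q * length M₁ + q * length M₂
        ≡⟨ *-distribˡ-+ q (length M₁) (length M₂) ⟨
      q * (length M₁ + length M₂)
        ≡⟨ cong (q *_) (trans (length-map proj₂ M) (length-++ M₁)) ⟨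
      q * size G ∎
      where
      open ≤-Reasoning
      double₁ : ∀ a → 2 * (3 * a) ≡ 6 * a
      double₁ = solve-∀
      double₂ : ∀ a b → a * (2 * b) ≡ 2 * (a * b)
      double₂ = solve-∀
      3A≤ : 3 * length A ≤ q * length M₁
      3A≤ = *-cancelˡ-≤ 2 (subst₂ _≤_ (sym (double₁ (length A))) (double₂ q (length M₁)) 6A≤)

  -- Passage to extremal numbers and rational arithmetic

  edgeless : ∀ {r n} → Hypergraph r n
  edgeless = mkHypergraph [] [] []

  ex-upper : ∀ {m n} (F : Graph m) {G : Graph n} → Free F G → size G ≤ ex n F
  ex-upper F {G} = maxSize-upper {P = Free F} (λ G → ¬? (copy? F G)) {G}

  ex-Berge-attained : ∀ {m r n} (F : Graph m) {H₀ : Hypergraph r n} → BergeFree F H₀ →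
                      ∃ λ (H : Hypergraph r n) → BergeFree F H × size H ≡ ex-Berge r n F
  ex-Berge-attained F {H₀} free = maxSize-attained {P = BergeFree F} (λ H → ¬? (bergeCopy? F H)) (H₀ , free)

  -- The bound is applied to an extremal hypergraph. `H₀` guarantees that one exists, as `maxSize`
  -- takes the value 0 by default when nothing qualifies.
  ex-Berge≤ex : ∀ {m r n} (F : Graph m) p q {H₀ : Hypergraph r n} → BergeFree F H₀ →
                (∀ (H : Hypergraph r n) → BergeFree F H → ∃ λ (G : Graph n) → Free F G × p * size H ≤ q * size G) →
                p * ex-Berge r n F ≤ q * ex n F
  ex-Berge≤ex {r = r} {n} F p q H₀-free bound
    with H , H-free , size≡ ← ex-Berge-attained F H₀-free
    with G , G-free , pH≤qG ← bound H H-free =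
    subst (λ s → p * s ≤ q * ex n F) size≡ (≤-trans pH≤qG (*-monoʳ-≤ q (ex-upper F {G} G-free)))

  ex₃-Berge-cycle≤ : ∀ {m q} (m≥3 : m ≥ 3) n → q ≥ 3 → 3 + q ≡ m →
                    3 * ex-Berge 3 n (C m m≥3) ≤ q * ex n (C m m≥3)
  ex₃-Berge-cycle≤ {q = q} m≥3 n q≥3 refl =
    -- A Berge copy in the edgeless hypergraph would have to send the first cycle edge into `Fin 0`.
    ex-Berge≤ex {n = n} (C (3 + q) m≥3) 3 q {edgeless} (λ c → ¬Fin0 (BergeCopy.f c zero))
      (bergeFree⇒free q≥3 m≥3)

  -- In unnormalised rationals the inequality is mere cross multiplication. `mkℚᵘ` takes the
  -- denominator minus one, so 0 and 2 stand for the denominators 1 and 3.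
  /-≤-* : ∀ a b c → 3 * a ≤ b * c → ℤ.+ a ℚ./ 1 ℚ.≤ (ℤ.+ b ℚ./ 3) ℚ.* (ℤ.+ c ℚ./ 1)
  /-≤-* a b c 3a≤bc = ℚₚ.toℚᵘ-cancel-≤ (begin
    ℚ.toℚᵘ (ℤ.+ a ℚ./ 1)                               ≃⟨ ℚₚ.toℚᵘ-fromℚᵘ (ℚᵘ.mkℚᵘ (ℤ.+ a) 0) ⟩
    ℚᵘ.mkℚᵘ (ℤ.+ a) 0                                  ≤⟨ ℚᵘ.*≤* numerators ⟩
    ℚᵘ.mkℚᵘ (ℤ.+ b) 2 ℚᵘ.* ℚᵘ.mkℚᵘ (ℤ.+ c) 0           ≃⟨ ℚᵘₚ.*-cong (ℚₚ.toℚᵘ-fromℚᵘ (ℚᵘ.mkℚᵘ (ℤ.+ b) 2)) (ℚₚ.toℚᵘ-fromℚᵘ (ℚᵘ.mkℚᵘ (ℤ.+ c) 0)) ⟨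
    ℚ.toℚᵘ (ℤ.+ b ℚ./ 3) ℚᵘ.* ℚ.toℚᵘ (ℤ.+ c ℚ./ 1)     ≃⟨ ℚₚ.toℚᵘ-homo-* (ℤ.+ b ℚ./ 3) (ℤ.+ c ℚ./ 1) ⟨
    ℚ.toℚᵘ ((ℤ.+ b ℚ./ 3) ℚ.* (ℤ.+ c ℚ./ 1))           ∎)
    where
    open ℚᵘₚ.≤-Reasoning
    numerators : ℤ.+ a ℤ.* ℤ.+ 3 ℤ.≤ ℤ.+ b ℤ.* ℤ.+ c ℤ.* ℤ.+ 1
    numerators = subst₂ ℤ._≤_ (trans (ℤₚ.pos-* 3 a) (ℤₚ.*-comm (ℤ.+ 3) (ℤ.+ a)))
      (trans (ℤₚ.pos-* b c) (sym (ℤₚ.*-identityʳ _))) (ℤ.+≤+ 3a≤bc)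

open import Data.Nat.Base using (ℕ; _≥_; _∸_) renaming (_*_ to _*ℕ_)
open import Data.Integer.Base using (+_)
open import Data.Rational.Base using (_/_; _≤_; _*_)
open import Data.Nat.Properties using (∸-monoˡ-≤; *-monoʳ-≤; m+[n∸m]≡n)
open BergeCycles using (/-≤-*; ex₃-Berge-cycle≤)

theorem14 : (k : ℕ) (k≥3 : k ≥ 3) (n : ℕ) → n ≥ 1 →
    let C₂ₖ = C (2 *ℕ k) (2*k≥3 k≥3) in
    + ex-Berge 3 n C₂ₖ / 1 ≤ (+ (2 *ℕ k ∸ 3) / 3) * (+ ex n C₂ₖ / 1)
theorem14 k k≥3 n _ =
  /-≤-* (ex-Berge 3 n (C (2 *ℕ k) (2*k≥3 k≥3))) (2 *ℕ k ∸ 3) (ex n (C (2 *ℕ k) (2*k≥3 k≥3)))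
    -- The condition `q ≥ 3` is `2 * 3 ∸ 3 ≤ 2 * k ∸ 3` after evaluation, and `2*k≥3` ensures that
    -- the truncated subtraction is exact.
    (ex₃-Berge-cycle≤ (2*k≥3 k≥3) n (∸-monoˡ-≤ 3 (*-monoʳ-≤ 2 k≥3)) (m+[n∸m]≡n (2*k≥3 k≥3)))
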